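{- For every integer $n\geq 10$ there exists a maximum 8-cycle packing of $K_n$ which is not almost 2-perfect.
   Context: An 8-cycle packing of $K_n$ on an $n$-element vertex set $\mathcal{X}$ is a triple $(\mathcal{X},\mathcal{C},\mathcal{L})$ where $\mathcal{C}$ is a collection of pairwise edge-disjoint 8-cycles of $K_n$ and the leave $\mathcal{L}$ is the set of edges of $K_n$ lying in no cycle of $\mathcal{C}$. It is a maximum packing if $|\mathcal{L}|$ is as small as possible among all 8-cycle packings of $K_n$. For an 8-cycle $C$, an inside 8-cycle of $C$ is an 8-cycle on the same vertex set as $C$ sharing no edge with $C$. The packing is almost 2-perfect (A2P) if one can choose, for each $C\in\mathcal{C}$, an inside 8-cycle $C'$ of $C$ such that the chosen cycles $\mathcal{C}'$ are pairwise edge-disjoint and contain no edge of $\mathcal{L}$, i.e. $(\mathcal{X},\mathcal{C}',\mathcal{L})$ is again an 8-cycle packing with the same leave. -}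

module Defs where

open import Data.Fin using (Fin; toℕ; _<?_)
open import Data.Fin.Properties using (_≟_; any?)
open import Data.List using (List; length; filter; allFin; cartesianProduct)
open import Data.List.Relation.Binary.Pointwise using (Pointwise)
open import Data.List.Relation.Unary.All using (All)
open import Data.List.Relation.Unary.AllPairs using (AllPairs)
open import Data.List.Relation.Unary.Any as Any using (Any)
open import Data.Nat using (ℕ; suc; _≤_)
open import Data.Nat.DivMod using (_mod_)
open import Data.Product using (Σ-syntax; ∃-syntax; _×_; _,_; uncurry)
open import Data.Sum using (_⊎_)
open import Function.Bundles using (_⇔_)
open import Function.Definitions using (Injective)
open import Relation.Binary.PropositionalEquality using (_≡_)
open import Relation.Nullary using (¬_; Dec)
open import Relation.Nullary.Decidable using (¬?; _×-dec_; _⊎-dec_)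

-- An 8-cycle is presented by a cyclic listing of its vertices. Presentations
-- that differ by rotation or reflection are the same cycle, so everything
-- below only refers to a cycle through its vertices and its edges.
record Cycle₈ (n : ℕ) : Set where
  field
    vertex    : Fin 8 → Fin n
    injective : Injective _≡_ _≡_ vertex

open Cycle₈ public

next : Fin 8 → Fin 8
next i = suc (toℕ i) mod 8

module _ {n : ℕ} where

  _∈ⱽ_ : Fin n → Cycle₈ n → Set
  x ∈ⱽ C = ∃[ i ] vertex C i ≡ x

  _∈ᴱ_ : Fin n × Fin n → Cycle₈ n → Set
  (a , b) ∈ᴱ C = ∃[ i ] ((vertex C i ≡ a × vertex C (next i) ≡ b)
                       ⊎ (vertex C i ≡ b × vertex C (next i) ≡ a))

  _∈ᴱ?_ : ∀ e C → Dec (e ∈ᴱ C)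
  (a , b) ∈ᴱ? C =
    any? λ i → ((vertex C i ≟ a) ×-dec (vertex C (next i) ≟ b))
         ⊎-dec ((vertex C i ≟ b) ×-dec (vertex C (next i) ≟ a))

  EdgeDisjoint : Cycle₈ n → Cycle₈ n → Set
  EdgeDisjoint C D = ∀ e → e ∈ᴱ C → ¬ (e ∈ᴱ D)

  _InsideOf_ : Cycle₈ n → Cycle₈ n → Set
  C′ InsideOf C = (∀ x → x ∈ⱽ C′ ⇔ x ∈ⱽ C) × EdgeDisjoint C′ C

-- Each edge {a , b} of Kₙ is listed exactly once, as (a , b) with a < b.
edges : (n : ℕ) → List (Fin n × Fin n)
edges n = filter (uncurry _<?_) (cartesianProduct (allFin n) (allFin n))

record Packing (n : ℕ) : Set where
  field
    cycles   : List (Cycle₈ n)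
    disjoint : AllPairs EdgeDisjoint cycles

open Packing public

module _ {n : ℕ} where

  leave : Packing n → List (Fin n × Fin n)
  leave P = filter (λ e → ¬? (Any.any? (e ∈ᴱ?_) (cycles P))) (edges n)

  IsMaximum : Packing n → Set
  IsMaximum P = (Q : Packing n) → length (leave P) ≤ length (leave Q)

  Almost2Perfect : Packing n → Set
  Almost2Perfect P =
    Σ[ P′ ∈ Packing n ]
      Pointwise _InsideOf_ (cycles P′) (cycles P)
      × All (λ C′ → All (λ e → ¬ (e ∈ᴱ C′)) (leave P)) (cycles P′)

{-# OPTIONS --safe #-}
module Submission where

-- In a packing the edges at a vertex x are split between the leave and the cycles through x, two
-- for each cycle. This fixes the size of the leave modulo 8, and makes every leave degree odd if n
-- is even, and even if n is odd (so that a nonempty leave has at least 3 edges): the resulting lower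
-- bounds are attained.
--
-- The same count shows that the inside cycles of an almost 2-perfect packing cover exactly the edges
-- covered by the packing. Hence a packing is not almost 2-perfect if it has a "lonely" edge ab: one
-- such that a and b lie together only on the cycle containing ab. No edge of K₁₀ can be lonely, and
-- there a search through all choices of inside cycles is needed.
--
-- An almost 2-perfect packing restricts to one on any part of its cycles, provided that the other
-- cycles have no edge within the vertices of the part. So the obstruction survives gluing: an even
-- n grows by 8, adding K₈ minus a perfect matching and K_(n,8); an odd n = 17 + w is obtained from
-- K₁₇ and a maximum packing of K_(w+1) sharing one vertex, together with the bipartite K_(16,w).

open import Data.Bool using (Bool; true; false; if_then_else_)
import Data.Bool.Properties as Bool
open import Data.Empty using (⊥; ⊥-elim)
open import Data.Fin as Fin using (Fin; zero; suc; toℕ; fromℕ<; #_; _↑ˡ_; _↑ʳ_; splitAt; join)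
open import Data.Fin.Properties as Fin using (_≟_; any?; all?; <-cmp; ↑ˡ-injective; ↑ʳ-injective; splitAt-↑ˡ; splitAt-↑ʳ; join-splitAt; fromℕ<-injective; toℕ-fromℕ<)
open import Data.List using (List; []; _∷_; [_]; _++_; length; map; filter; concatMap; tabulate; allFin; cartesianProduct)
open import Data.List.Membership.Propositional using (_∈_; lose)
open import Data.List.Membership.Propositional.Properties using (∈-filter⁺; ∈-cartesianProduct⁺; ∈-allFin; ∈-map⁺; ∈-concat⁺′)
open import Data.List.Properties using (filter-++; length-++; length-map; map-tabulate)
open import Data.List.Relation.Binary.Pointwise using (Pointwise; []; _∷_)
open import Data.List.Relation.Unary.All as All using (All; []; _∷_)
import Data.List.Relation.Unary.All.Properties as All
open import Data.List.Relation.Unary.AllPairs as AllPairs using (AllPairs; []; _∷_)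
import Data.List.Relation.Unary.AllPairs.Properties as AllPairs
open import Data.List.Relation.Unary.Any as Any using (Any; here; there)
import Data.List.Relation.Unary.Any.Properties as Any
open import Data.Nat as ℕ using (ℕ; zero; suc; pred; _+_; _*_; _∸_; _≤_; _<_; z≤n; s≤s)
open import Data.Nat.Divisibility using (_∣_; divides; m∣m*n; ∣m+n∣m⇒∣n)
open import Data.Nat.DivMod using (_mod_)
open import Data.Nat.ListAction using (sum)
open import Data.Nat.Properties hiding (_≟_; _≤?_; _<?_; <-cmp)
open import Data.Nat.Tactic.RingSolver using (solve-∀)
open import Data.Product using (Σ-syntax; ∃-syntax; _×_; _,_; proj₁; proj₂; uncurry)
open import Data.Sum using (_⊎_; inj₁; inj₂; [_,_]′; swap)
open import Data.Unit using (⊤; tt)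
open import Data.Vec as Vec using (Vec; []; _∷_; lookup)
open import Data.Vec.Properties using (lookup∘tabulate)
open import Function using (_∘_; id)
open import Function.Bundles using (_⇔_; Equivalence; mk⇔)
open import Function.Definitions using (Injective)
open import Relation.Binary.Definitions using (Tri; tri<; tri≈; tri>)
open import Relation.Binary.PropositionalEquality hiding ([_])
open import Relation.Nullary using (¬_; Dec; yes; no; does; contradiction)
open import Relation.Nullary.Decidable using (True; False; toWitness; toWitnessFalse; decidable-stable; dec-true; dec-false; ¬?; _×-dec_; _⊎-dec_; _→-dec_)
open import Relation.Unary using (Decidable)
open import Algebra.Properties.CommutativeMonoid.Sum +-0-commutativeMonoid using (sum-syntax; sum-cong-≗; ∑-distrib-+; ∑-comm)
open import Defs

private variable
  m n w N : ℕ
  A B : Set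

-- Sums of indicators over finite sets.

ind : Dec A → ℕ
ind a? = if does a? then 1 else 0

ind-yes : (a? : Dec A) → A → ind a? ≡ 1
ind-yes a? a rewrite dec-true a? a = refl

ind-no : (a? : Dec A) → ¬ A → ind a? ≡ 0
ind-no a? ¬a rewrite dec-false a? ¬a = refl

ind-cong : (a? : Dec A) (b? : Dec B) → (A → B) → (B → A) → ind a? ≡ ind b?
ind-cong (yes a) b? f g = sym (ind-yes b? (f a))
ind-cong (no ¬a) b? f g = sym (ind-no b? (¬a ∘ g))

∑-zero : {f : Fin n → ℕ} → (∀ i → f i ≡ 0) → ∑[ i < n ] f i ≡ 0
∑-zero {zero}  f≡0 = refl
∑-zero {suc n} f≡0 = cong₂ _+_ (f≡0 zero) (∑-zero (f≡0 ∘ suc))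

∑-const : ∀ n k → ∑[ i < n ] k ≡ n * k
∑-const zero    k = refl
∑-const (suc n) k = cong (k +_) (∑-const n k)

∑-mono : {f g : Fin n → ℕ} → (∀ i → f i ≤ g i) → ∑[ i < n ] f i ≤ ∑[ i < n ] g i
∑-mono {zero}  f≤g = z≤n
∑-mono {suc n} f≤g = +-mono-≤ (f≤g zero) (∑-mono (f≤g ∘ suc))

∑-*ˡ : ∀ k (f : Fin n → ℕ) → ∑[ i < n ] (k * f i) ≡ k * ∑[ i < n ] f i
∑-*ˡ {zero}  k f = sym (*-zeroʳ k)
∑-*ˡ {suc n} k f = trans (cong (k * f zero +_) (∑-*ˡ k (f ∘ suc))) (sym (*-distribˡ-+ k (f zero) _))

∑-positive : (f : Fin n → ℕ) → 0 < ∑[ i < n ] f i → ∃[ i ] 0 < f i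
∑-positive {suc n} f pos with f zero in eq
... | suc _ = zero , subst (0 <_) (sym eq) (s≤s z≤n)
... | zero with i , p ← ∑-positive (f ∘ suc) pos = suc i , p

term≤∑ : (f : Fin n → ℕ) (i : Fin n) → f i ≤ ∑[ j < n ] f j
term≤∑ f zero    = m≤m+n (f zero) _
term≤∑ f (suc i) = ≤-trans (term≤∑ (f ∘ suc) i) (m≤n+m _ (f zero))

-- A strict inequality at one index would make the totals differ. This turns an inclusion between
-- two sets of edges of equal size into an equality.
∑-rigid : {f g : Fin n → ℕ} → (∀ i → f i ≤ g i) → ∑[ i < n ] f i ≡ ∑[ i < n ] g i → ∀ i → f i ≡ g i
∑-rigid {suc n} {f} {g} f≤g eq zero = ≤-antisym (f≤g zero)
  (+-cancelʳ-≤ _ _ _ (≤-trans (+-monoʳ-≤ (g zero) (∑-mono (f≤g ∘ suc))) (≤-reflexive (sym eq))))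
∑-rigid {suc n} {f} {g} f≤g eq (suc i) = ∑-rigid (f≤g ∘ suc)
  (+-cancelˡ-≡ (f zero) _ _ (trans eq (cong (_+ _) (sym (∑-rigid f≤g eq zero))))) i

∑-ind-unique : {P : Fin n → Set} (P? : Decidable P) (i : Fin n) → P i → (∀ j → P j → j ≡ i) →
               ∑[ j < n ] ind (P? j) ≡ 1
∑-ind-unique P? zero p unique = cong₂ _+_ (ind-yes (P? zero) p)
  (∑-zero λ j → ind-no (P? (suc j)) λ pj → Fin.0≢1+n (sym (unique (suc j) pj)))
∑-ind-unique P? (suc i) p unique = cong₂ _+_ (ind-no (P? zero) λ p0 → Fin.0≢1+n (unique zero p0))
  (∑-ind-unique (P? ∘ suc) i p λ j pj → Fin.suc-injective (unique (suc j) pj))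

∑-ind-≟ : (x : Fin n) → ∑[ y < n ] ind (x ≟ y) ≡ 1
∑-ind-≟ x = ∑-ind-unique (x ≟_) x refl λ _ → sym

-- Uniqueness leaves at most one nonzero term. In this way the vertices of a cycle can be counted by
-- their positions.
ind-∃ : {P : Fin n → Set} (P? : Decidable P) (∃P? : Dec (∃[ i ] P i)) → (∀ i j → P i → P j → i ≡ j) →
        ind ∃P? ≡ ∑[ i < n ] ind (P? i)
ind-∃ P? (yes (i , p)) unique = sym (∑-ind-unique P? i p λ j q → unique j i q p)
ind-∃ P? (no ¬∃P)      unique = sym (∑-zero λ i → ind-no (P? i) λ p → ¬∃P (i , p))

∑-sum : {C : Set} (f : C → Fin n → ℕ) (cs : List C) →
        ∑[ x < n ] sum (map (λ C → f C x) cs) ≡ sum (map (λ C → ∑[ x < n ] f C x) cs)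
∑-sum {n} f []   = ∑-zero {n} λ _ → refl
∑-sum f (C ∷ cs) = trans (∑-distrib-+ (f C) _) (cong (_ +_) (∑-sum f cs))

length-filter-tabulate : {P : A → Set} (P? : Decidable P) (f : Fin n → A) →
                         length (filter P? (tabulate f)) ≡ ∑[ i < n ] ind (P? (f i))
length-filter-tabulate {n = zero}  P? f = refl
length-filter-tabulate {n = suc n} P? f with does (P? (f zero))
... | true  = cong suc (length-filter-tabulate P? (f ∘ suc))
... | false = length-filter-tabulate P? (f ∘ suc)

length-filter-product : ∀ {m} {P : A × B → Set} (P? : Decidable P) (f : Fin m → A) (g : Fin n → B) →
  length (filter P? (cartesianProduct (tabulate f) (tabulate g))) ≡
  ∑[ i < m ] ∑[ j < n ] ind (P? (f i , g j))
length-filter-product {m = zero}  P? f g = refl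
length-filter-product {m = suc m} P? f g = begin
  length (filter P? (map (f zero ,_) (tabulate g) ++ rest))
    ≡⟨ cong length (filter-++ P? (map (f zero ,_) (tabulate g)) rest) ⟩
  length (filter P? (map (f zero ,_) (tabulate g)) ++ filter P? rest)
    ≡⟨ length-++ (filter P? (map (f zero ,_) (tabulate g))) ⟩
  length (filter P? (map (f zero ,_) (tabulate g))) + length (filter P? rest)
    ≡⟨ cong₂ _+_ (trans (cong (length ∘ filter P?) (map-tabulate g (f zero ,_)))
                        (length-filter-tabulate P? λ j → f zero , g j))
                 (length-filter-product P? (f ∘ suc) g) ⟩
  _ ∎
  where
  open ≡-Reasoning
  rest = cartesianProduct (tabulate (f ∘ suc)) (tabulate g)

filter-filter : {P Q : A → Set} (P? : Decidable P) (Q? : Decidable Q) (xs : List A) →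
                filter P? (filter Q? xs) ≡ filter (λ x → Q? x ×-dec P? x) xs
filter-filter P? Q? [] = refl
filter-filter P? Q? (x ∷ xs) with does (Q? x)
... | false = filter-filter P? Q? xs
... | true with does (P? x)
...   | true  = cong (x ∷_) (filter-filter P? Q? xs)
...   | false = filter-filter P? Q? xs

-- Degrees in cycles and leaves, and the edge count of a packing.

prev : Fin 8 → Fin 8
prev i = (7 + toℕ i) mod 8

next-prev : ∀ i → next (prev i) ≡ i
next-prev = toWitness {a? = all? λ i → next (prev i) ≟ i} _

prev-next : ∀ i → prev (next i) ≡ i
prev-next = toWitness {a? = all? λ i → prev (next i) ≟ i} _

next≢prev : ∀ i → next i ≢ prev i
next≢prev = toWitness {a? = all? λ i → ¬? (next i ≟ prev i)} _

next≢id : ∀ i → next i ≢ i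
next≢id = toWitness {a? = all? λ i → ¬? (next i ≟ i)} _

module _ {n : ℕ} where

  ∈ᴱ-sym : ∀ {a b} (C : Cycle₈ n) → (a , b) ∈ᴱ C → (b , a) ∈ᴱ C
  ∈ᴱ-sym C (i , inj₁ p) = i , inj₂ p
  ∈ᴱ-sym C (i , inj₂ p) = i , inj₁ p

  ∈ᴱ-irrefl : ∀ {a} (C : Cycle₈ n) → ¬ ((a , a) ∈ᴱ C)
  ∈ᴱ-irrefl C (i , inj₁ (p , q)) = next≢id i (injective C (trans q (sym p)))
  ∈ᴱ-irrefl C (i , inj₂ (p , q)) = next≢id i (injective C (trans q (sym p)))

  ∈ᴱ⇒≢ : ∀ {a b} (C : Cycle₈ n) → (a , b) ∈ᴱ C → a ≢ b
  ∈ᴱ⇒≢ C e refl = ∈ᴱ-irrefl C e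

  ∈ᴱ⇒∈ⱽ : ∀ {a b} (C : Cycle₈ n) → (a , b) ∈ᴱ C → a ∈ⱽ C
  ∈ᴱ⇒∈ⱽ C (i , inj₁ (p , _)) = i , p
  ∈ᴱ⇒∈ⱽ C (i , inj₂ (_ , q)) = next i , q

  infix 4 _∈ⱽ?_ _covers_ _covers?_

  _∈ⱽ?_ : ∀ x (C : Cycle₈ n) → Dec (x ∈ⱽ C)
  x ∈ⱽ? C = any? λ i → vertex C i ≟ x

  neighbours : (C : Cycle₈ n) (i : Fin 8) {y : Fin n} →
               (vertex C i , y) ∈ᴱ C → vertex C (next i) ≡ y ⊎ vertex C (prev i) ≡ y
  neighbours C i (j , inj₁ (p , q)) with refl ← injective C p = inj₁ q
  neighbours C i (j , inj₂ (p , q)) with refl ← injective C q = inj₂ (trans (cong (vertex C) (prev-next j)) p)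

  -- The neighbours of `vertex C i` on the cycle sit at `next i` and `prev i`. They are distinct by
  -- `next≢prev` and injectivity, so the indicator of adjacency is a sum of two point indicators.
  degree : (C : Cycle₈ n) (x : Fin n) →
           ∑[ y < n ] ind ((x , y) ∈ᴱ? C) ≡ 2 * ind (x ∈ⱽ? C)
  degree C x = go (x ∈ⱽ? C)
    where
    open ≡-Reasoning
    split : ∀ i y (p? : Dec (vertex C (next i) ≡ y)) (q? : Dec (vertex C (prev i) ≡ y)) →
            ind ((vertex C i , y) ∈ᴱ? C) ≡ ind p? + ind q?
    split i y (yes p) (yes q) = contradiction (injective C (trans p (sym q))) (next≢prev i)
    split i y (yes p) (no _)  = ind-yes (_ ∈ᴱ? C) (i , inj₁ (refl , p))
    split i y (no _)  (yes q) = ind-yes (_ ∈ᴱ? C) (prev i , inj₂ (q , cong (vertex C) (next-prev i)))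
    split i y (no ¬p) (no ¬q) = ind-no (_ ∈ᴱ? C) ([ ¬p , ¬q ]′ ∘ neighbours C i)
    go : (x∈? : Dec (x ∈ⱽ C)) → ∑[ y < n ] ind ((x , y) ∈ᴱ? C) ≡ 2 * ind x∈?
    go (no x∉C) = ∑-zero λ y → ind-no ((x , y) ∈ᴱ? C) (x∉C ∘ ∈ᴱ⇒∈ⱽ C)
    go (yes (i , refl)) = begin
      ∑[ y < n ] ind ((x , y) ∈ᴱ? C)
        ≡⟨ sum-cong-≗ (λ y → split i y (vertex C (next i) ≟ y) (vertex C (prev i) ≟ y)) ⟩
      ∑[ y < n ] (ind (vertex C (next i) ≟ y) + ind (vertex C (prev i) ≟ y))
        ≡⟨ ∑-distrib-+ (λ y → ind (vertex C (next i) ≟ y)) _ ⟩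
      ∑[ y < n ] ind (vertex C (next i) ≟ y) + ∑[ y < n ] ind (vertex C (prev i) ≟ y)
        ≡⟨ cong₂ _+_ (∑-ind-≟ (vertex C (next i))) (∑-ind-≟ (vertex C (prev i))) ⟩
      2 ∎

  order : (C : Cycle₈ n) → ∑[ x < n ] ind (x ∈ⱽ? C) ≡ 8
  order C = begin
    ∑[ x < n ] ind (x ∈ⱽ? C)
      ≡⟨ sum-cong-≗ (λ x → ind-∃ (λ i → vertex C i ≟ x) (x ∈ⱽ? C) λ i j p q → injective C (trans p (sym q))) ⟩
    ∑[ x < n ] ∑[ i < 8 ] ind (vertex C i ≟ x)
      ≡⟨ ∑-comm (λ x i → ind (vertex C i ≟ x)) ⟩
    ∑[ i < 8 ] ∑[ x < n ] ind (vertex C i ≟ x)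
      ≡⟨ sum-cong-≗ (λ i → ∑-ind-≟ (vertex C i)) ⟩
    8 ∎
    where open ≡-Reasoning

  _covers_ : List (Cycle₈ n) → Fin n × Fin n → Set
  cs covers e = Any (e ∈ᴱ_) cs

  _covers?_ : ∀ cs e → Dec (cs covers e)
  cs covers? e = Any.any? (e ∈ᴱ?_) cs

  covers-sym : ∀ {a b} (cs : List (Cycle₈ n)) → cs covers (a , b) → cs covers (b , a)
  covers-sym cs = Any.map (λ {C} → ∈ᴱ-sym C)

  Free : List (Cycle₈ n) → Fin n → Fin n → Set
  Free cs x y = x ≢ y × ¬ cs covers (x , y)

  free? : ∀ cs x y → Dec (Free cs x y)
  free? cs x y = ¬? (x ≟ y) ×-dec ¬? (cs covers? (x , y))

  leaveDegree : List (Cycle₈ n) → Fin n → ℕ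
  leaveDegree cs x = ∑[ y < n ] ind (free? cs x y)

  passes : List (Cycle₈ n) → Fin n → ℕ
  passes cs x = sum (map (λ C → ind (x ∈ⱽ? C)) cs)

  multiplicity : List (Cycle₈ n) → Fin n → Fin n → ℕ
  multiplicity cs x y = sum (map (λ C → ind ((x , y) ∈ᴱ? C)) cs)

  multiplicity-uncovered : ∀ cs x y → ¬ cs covers (x , y) → multiplicity cs x y ≡ 0
  multiplicity-uncovered []       x y _  = refl
  multiplicity-uncovered (C ∷ cs) x y ¬c =
    cong₂ _+_ (ind-no ((x , y) ∈ᴱ? C) (¬c ∘ here)) (multiplicity-uncovered cs x y (¬c ∘ there))

  multiplicity-covered : ∀ {cs} x y → AllPairs EdgeDisjoint cs → cs covers (x , y) → multiplicity cs x y ≡ 1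
  multiplicity-covered {C ∷ cs} x y (C# ∷ _) (here e∈C) = cong₂ _+_ (ind-yes ((x , y) ∈ᴱ? C) e∈C)
    (multiplicity-uncovered cs x y λ c → All.lookupAny C# c .proj₁ (x , y) e∈C (All.lookupAny C# c .proj₂))
  multiplicity-covered {C ∷ cs} x y (C# ∷ dis) (there c) = cong₂ _+_
    (ind-no ((x , y) ∈ᴱ? C) λ e∈C → All.lookupAny C# c .proj₁ (x , y) e∈C (All.lookupAny C# c .proj₂))
    (multiplicity-covered x y dis c)

  covers-irrefl : ∀ {x} cs → ¬ cs covers (x , x)
  covers-irrefl cs c with C , p ← Any.satisfied c = ∈ᴱ-irrefl C p

  -- A pair is on the diagonal, or free, or an edge of a cycle; edge-disjointness makes that cycle
  -- unique.
  edge-trichotomy : ∀ {cs} → AllPairs EdgeDisjoint cs → ∀ x y →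
                    ind (free? cs x y) + multiplicity cs x y + ind (x ≟ y) ≡ 1
  edge-trichotomy {cs} dis x y with x ≟ y | cs covers? (x , y)
  ... | yes refl | _ = cong (_+ 1) (multiplicity-uncovered cs x x (covers-irrefl cs))
  ... | no _ | yes c = trans (+-identityʳ _) (multiplicity-covered x y dis c)
  ... | no _ | no ¬c = cong (λ k → 1 + k + 0) (multiplicity-uncovered cs x y ¬c)

  -- Summing `edge-trichotomy` over `y`, each cycle through `x` contributes 2 and the diagonal
  -- contributes 1. The parity of leave degrees and the comparison of a packing with its inside
  -- cycles both rest on this.
  degree-equation : ∀ {cs} → AllPairs EdgeDisjoint cs → ∀ x →
                    leaveDegree cs x + 2 * passes cs x + 1 ≡ n
  degree-equation {cs} dis x = begin
    leaveDegree cs x + 2 * passes cs x + 1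
      ≡⟨ cong₂ (λ s t → leaveDegree cs x + s + t) (sym total-multiplicity) (sym (∑-ind-≟ x)) ⟩
    leaveDegree cs x + ∑[ y < n ] multiplicity cs x y + ∑[ y < n ] ind (x ≟ y)
      ≡⟨ cong (_+ ∑[ y < n ] ind (x ≟ y)) (sym (∑-distrib-+ (λ y → ind (free? cs x y)) _)) ⟩
    ∑[ y < n ] (ind (free? cs x y) + multiplicity cs x y) + ∑[ y < n ] ind (x ≟ y)
      ≡⟨ sym (∑-distrib-+ (λ y → ind (free? cs x y) + multiplicity cs x y) _) ⟩
    ∑[ y < n ] (ind (free? cs x y) + multiplicity cs x y + ind (x ≟ y))
      ≡⟨ sum-cong-≗ (edge-trichotomy dis x) ⟩
    ∑[ y < n ] 1
      ≡⟨ trans (∑-const n 1) (*-identityʳ n) ⟩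
    n ∎
    where
    open ≡-Reasoning
    double : ∀ ds → sum (map (λ C → ∑[ y < n ] ind ((x , y) ∈ᴱ? C)) ds) ≡ 2 * passes ds x
    double []       = refl
    double (C ∷ ds) = trans (cong₂ _+_ (degree C x) (double ds)) (sym (*-distribˡ-+ 2 (ind (x ∈ⱽ? C)) _))
    total-multiplicity : ∑[ y < n ] multiplicity cs x y ≡ 2 * passes cs x
    total-multiplicity = trans (∑-sum (λ C y → ind ((x , y) ∈ᴱ? C)) cs) (double cs)

  ∑-passes : ∀ cs → ∑[ x < n ] passes cs x ≡ length cs * 8
  ∑-passes cs = trans (∑-sum (λ C x → ind (x ∈ⱽ? C)) cs) (go cs)
    where
    go : ∀ ds → sum (map (λ C → ∑[ x < n ] ind (x ∈ⱽ? C)) ds) ≡ length ds * 8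
    go []       = refl
    go (C ∷ ds) = cong₂ _+_ (order C) (go ds)

  free-sym : ∀ cs {x y} → Free cs x y → Free cs y x
  free-sym cs (x≢y , ¬c) = x≢y ∘ sym , ¬c ∘ covers-sym cs

  -- The list `leave P` holds each edge in its increasing orientation, counted by `up`; a free pair
  -- is increasing in exactly one of its two orders.
  handshake : (P : Packing n) → ∑[ x < n ] leaveDegree (cycles P) x ≡ 2 * length (leave P)
  handshake P = begin
    ∑[ x < n ] ∑[ y < n ] ind (free? cs x y)
      ≡⟨ sum-cong-≗ (λ x → trans (sum-cong-≗ (oriented x)) (∑-distrib-+ (λ y → up x y) _)) ⟩
    ∑[ x < n ] (∑[ y < n ] up x y + ∑[ y < n ] up y x)
      ≡⟨ ∑-distrib-+ (λ x → ∑[ y < n ] up x y) _ ⟩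
    ∑[ x < n ] ∑[ y < n ] up x y + ∑[ x < n ] ∑[ y < n ] up y x
      ≡⟨ cong (∑[ x < n ] ∑[ y < n ] up x y +_) (∑-comm (λ x y → up y x)) ⟩
    ∑[ x < n ] ∑[ y < n ] up x y + ∑[ y < n ] ∑[ x < n ] up y x
      ≡⟨ cong₂ _+_ (sym leave-∑) (trans (sym leave-∑) (sym (+-identityʳ _))) ⟩
    2 * length (leave P) ∎
    where
    open ≡-Reasoning
    cs = cycles P
    up : Fin n → Fin n → ℕ
    up x y = ind (x Fin.<? y ×-dec ¬? (cs covers? (x , y)))
    leave-∑ : length (leave P) ≡ ∑[ x < n ] ∑[ y < n ] up x y
    leave-∑ = trans
      (cong length (filter-filter (λ e → ¬? (cs covers? e)) (uncurry Fin._<?_) (cartesianProduct (allFin n) (allFin n))))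
      (length-filter-product (λ e → uncurry Fin._<?_ e ×-dec ¬? (cs covers? e)) id id)
    oriented : ∀ x y → ind (free? cs x y) ≡ up x y + up y x
    oriented x y with <-cmp x y
    ... | tri< x<y x≢y y≮x = trans
      (ind-cong (free? cs x y) (x Fin.<? y ×-dec ¬? (cs covers? (x , y))) (λ (_ , ¬c) → x<y , ¬c) (λ (_ , ¬c) → x≢y , ¬c))
      (sym (trans (cong (up x y +_) (ind-no (y Fin.<? x ×-dec ¬? (cs covers? (y , x))) (y≮x ∘ proj₁))) (+-identityʳ _)))
    ... | tri≈ x≮y x≡y y≮x = trans (ind-no (free? cs x y) (λ (x≢y , _) → x≢y x≡y))
      (sym (cong₂ _+_ (ind-no (x Fin.<? y ×-dec ¬? (cs covers? (x , y))) (x≮y ∘ proj₁))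
                      (ind-no (y Fin.<? x ×-dec ¬? (cs covers? (y , x))) (y≮x ∘ proj₁))))
    ... | tri> x≮y x≢y y<x = trans
      (ind-cong (free? cs x y) (y Fin.<? x ×-dec ¬? (cs covers? (y , x)))
        (λ (_ , ¬c) → y<x , ¬c ∘ covers-sym cs) (λ (_ , ¬c) → x≢y , ¬c ∘ covers-sym cs))
      (sym (cong (_+ up y x) (ind-no (x Fin.<? y ×-dec ¬? (cs covers? (x , y))) (x≮y ∘ proj₁))))

  -- The sum of `degree-equation` over all vertices, where each cycle is passed 8 times. It stays
  -- doubled so that nothing has to be halved.
  edge-count : (P : Packing n) → 2 * length (leave P) + 16 * length (cycles P) + n ≡ n * n
  edge-count P = begin
    2 * length (leave P) + 16 * length cs + n
      ≡⟨ cong₂ (λ s t → s + t + n) (sym (handshake P)) (16c≡ (length cs)) ⟩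
    ∑[ x < n ] leaveDegree cs x + 2 * (length cs * 8) + n
      ≡⟨ cong (λ s → ∑[ x < n ] leaveDegree cs x + 2 * s + n) (sym (∑-passes cs)) ⟩
    ∑[ x < n ] leaveDegree cs x + 2 * ∑[ x < n ] passes cs x + n
      ≡⟨ cong₂ (λ s t → ∑[ x < n ] leaveDegree cs x + s + t) (sym (∑-*ˡ 2 (passes cs))) (sym n≡∑1) ⟩
    ∑[ x < n ] leaveDegree cs x + ∑[ x < n ] (2 * passes cs x) + ∑[ x < n ] 1
      ≡⟨ cong (_+ ∑[ x < n ] 1) (sym (∑-distrib-+ (leaveDegree cs) _)) ⟩
    ∑[ x < n ] (leaveDegree cs x + 2 * passes cs x) + ∑[ x < n ] 1
      ≡⟨ sym (∑-distrib-+ (λ x → leaveDegree cs x + 2 * passes cs x) _) ⟩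
    ∑[ x < n ] (leaveDegree cs x + 2 * passes cs x + 1)
      ≡⟨ sum-cong-≗ (degree-equation (disjoint P)) ⟩
    ∑[ x < n ] n
      ≡⟨ ∑-const n n ⟩
    n * n ∎
    where
    open ≡-Reasoning
    cs = cycles P
    n≡∑1 : ∑[ x < n ] 1 ≡ n
    n≡∑1 = trans (∑-const n 1) (*-identityʳ n)
    16c≡ : ∀ c → 16 * c ≡ 2 * (c * 8)
    16c≡ = solve-∀

-- Lower bounds for the size of a leave.

module _ {n : ℕ} where

  -- By `edge-count` a smaller leave must be paid for by at least one more cycle, which takes 8
  -- edges.
  leave-gap : (P Q : Packing n) → length (leave Q) < length (leave P) → length (leave Q) + 8 ≤ length (leave P)
  leave-gap P Q lt = *-cancelˡ-≤ 2 (+-cancelʳ-≤ (16 * p) _ _ (begin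
    2 * (lQ + 8) + 16 * p    ≡⟨ regroup lQ p ⟩
    2 * lQ + 16 * suc p      ≤⟨ +-monoʳ-≤ (2 * lQ) (*-monoʳ-≤ 16 p<q) ⟩
    2 * lQ + 16 * q          ≡⟨ sym equal ⟩
    2 * lP + 16 * p          ∎))
    where
    open ≤-Reasoning
    lP = length (leave P)
    lQ = length (leave Q)
    p = length (cycles P)
    q = length (cycles Q)
    equal : 2 * lP + 16 * p ≡ 2 * lQ + 16 * q
    equal = +-cancelʳ-≡ n _ _ (trans (edge-count P) (sym (edge-count Q)))
    p<q : p < q
    p<q = *-cancelˡ-< 16 p q (≰⇒> λ 16q≤16p → <⇒≱ lt (*-cancelˡ-≤ 2 (+-cancelʳ-≤ (16 * p) _ _
      (≤-trans (≤-reflexive equal) (+-monoʳ-≤ (2 * lQ) 16q≤16p)))))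
    regroup : ∀ l c → 2 * (l + 8) + 16 * c ≡ 2 * l + 16 * suc c
    regroup = solve-∀

  module Even (k : ℕ) (n≡2k : n ≡ 2 * k) where

    -- For even `n` the leave degree in `degree-equation` is odd, hence not 0.
    leaveDegree-positive : (Q : Packing n) → ∀ x → 1 ≤ leaveDegree (cycles Q) x
    leaveDegree-positive Q x = n≢0⇒n>0 λ d≡0 → even≢odd k (passes (cycles Q) x) (begin
      2 * k                                                      ≡⟨ sym n≡2k ⟩
      n                                                          ≡⟨ sym (degree-equation (disjoint Q) x) ⟩
      leaveDegree (cycles Q) x + 2 * passes (cycles Q) x + 1     ≡⟨ cong (λ d → d + 2 * passes (cycles Q) x + 1) d≡0 ⟩
      2 * passes (cycles Q) x + 1                                ≡⟨ +-comm _ 1 ⟩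
      suc (2 * passes (cycles Q) x)                              ∎)
      where open ≡-Reasoning

    -- Positive degrees give every leave at least `n / 2` edges. A leave smaller than that of `P`
    -- would be smaller by 8, which `small` leaves no room for.
    maximum : (P : Packing n) → 2 * length (leave P) < n + 16 → IsMaximum P
    maximum P small Q = ≮⇒≥ λ lt → <⇒≱ small (begin
      n + 16                                     ≡⟨ cong (_+ 16) (sym (trans (∑-const n 1) (*-identityʳ n))) ⟩
      ∑[ x < n ] 1 + 16                          ≤⟨ +-monoˡ-≤ 16 (∑-mono (leaveDegree-positive Q)) ⟩
      ∑[ x < n ] leaveDegree (cycles Q) x + 16   ≡⟨ cong (_+ 16) (handshake Q) ⟩
      2 * length (leave Q) + 2 * 8               ≡⟨ sym (*-distribˡ-+ 2 (length (leave Q)) 8) ⟩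
      2 * (length (leave Q) + 8)                 ≤⟨ *-monoʳ-≤ 2 (leave-gap P Q lt) ⟩
      2 * length (leave P)                       ∎)
      where open ≤-Reasoning

  module Odd (k : ℕ) (n≡1+2k : n ≡ suc (2 * k)) where

    leaveDegree-≢1 : (Q : Packing n) → ∀ x → leaveDegree (cycles Q) x ≢ 1
    leaveDegree-≢1 Q x d≡1 = even≢odd k (passes (cycles Q) x) (cong pred (begin
      suc (2 * k)                                                ≡⟨ sym n≡1+2k ⟩
      n                                                          ≡⟨ sym (degree-equation (disjoint Q) x) ⟩
      leaveDegree (cycles Q) x + 2 * passes (cycles Q) x + 1     ≡⟨ cong (λ d → d + 2 * passes (cycles Q) x + 1) d≡1 ⟩
      suc (2 * passes (cycles Q) x + 1)                          ≡⟨ cong suc (+-comm _ 1) ⟩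
      suc (suc (2 * passes (cycles Q) x))                        ∎))
      where open ≡-Reasoning

    -- Leave degrees are different from 1, so a vertex `x` of positive leave degree `d` and its `d`
    -- neighbours in the leave all have degree at least 2. Hence `2 * (d + 1)` is at most the sum of
    -- all degrees, which is twice the size of the leave.
    leave-≥3 : (Q : Packing n) → 0 < length (leave Q) → 3 ≤ length (leave Q)
    leave-≥3 Q nonempty = ≤-trans (+-monoˡ-≤ 1 2≤d) (*-cancelˡ-≤ 2 (begin
      2 * (leaveDegree cs x + 1)
        ≡⟨ cong (λ s → 2 * (leaveDegree cs x + s)) (sym (∑-ind-≟ x)) ⟩
      2 * (leaveDegree cs x + ∑[ y < n ] ind (x ≟ y))
        ≡⟨ cong (2 *_) (sym (∑-distrib-+ (λ y → ind (free? cs x y)) _)) ⟩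
      2 * ∑[ y < n ] (ind (free? cs x y) + ind (x ≟ y))
        ≡⟨ sym (∑-*ˡ 2 (λ y → ind (free? cs x y) + ind (x ≟ y))) ⟩
      ∑[ y < n ] (2 * (ind (free? cs x y) + ind (x ≟ y)))
        -- The two indicators together select `x` and its neighbours in the leave.
        ≤⟨ ∑-mono (λ y → closed-neighbourhood y (free? cs x y) (x ≟ y)) ⟩
      ∑[ y < n ] leaveDegree cs y
        ≡⟨ handshake Q ⟩
      2 * length (leave Q) ∎))
      where
      open ≤-Reasoning
      cs = cycles Q
      witness : ∃[ x ] 0 < leaveDegree cs x
      witness = ∑-positive (leaveDegree cs) (subst (0 <_) (sym (handshake Q)) (*-monoʳ-< 2 nonempty))
      x = proj₁ witness
      ≥2 : ∀ y → 0 < leaveDegree cs y → 2 ≤ leaveDegree cs y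
      ≥2 y pos = ≤∧≢⇒< pos (leaveDegree-≢1 Q y ∘ sym)
      2≤d : 2 ≤ leaveDegree cs x
      2≤d = ≥2 x (proj₂ witness)
      closed-neighbourhood : ∀ y (f? : Dec (Free cs x y)) (e? : Dec (x ≡ y)) → 2 * (ind f? + ind e?) ≤ leaveDegree cs y
      closed-neighbourhood y (yes (x≢y , _)) (yes x≡y) = contradiction x≡y x≢y
      closed-neighbourhood y (yes f) (no _) = ≥2 y (≤-trans (≤-reflexive (sym (ind-yes (free? cs y x) (free-sym cs f))))
                                                           (term≤∑ (λ z → ind (free? cs y z)) x))
      closed-neighbourhood y (no _) (yes refl) = 2≤d
      closed-neighbourhood y (no _) (no _) = z≤n

    -- A smaller leave has at most `10 - 8 = 2` edges, so it is empty by `leave-≥3`. Then 8 divides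
    -- the number of edges of the complete graph and with it the size of the leave of `P`, which
    -- lies between 8 and 10 and so is 8, the excluded value.
    maximum : (P : Packing n) → length (leave P) ≤ 10 → length (leave P) ≢ 8 → IsMaximum P
    maximum P ≤10 ≢8 Q = ≮⇒≥ λ lt → absurd (leave-gap P Q lt)
      where
      lP = length (leave P)
      absurd : length (leave Q) + 8 ≤ lP → ⊥
      absurd gap = not-multiple lP ≤10 (≤-trans (m≤n+m 8 _) gap) ≢8
        (∣m+n∣m⇒∣n {m = 8 * length (cycles P)} (divides (length (cycles Q)) lP≡) (m∣m*n (length (cycles P))))
        where
        leaveQ≡0 : length (leave Q) ≡ 0
        leaveQ≡0 = n≤0⇒n≡0 (≮⇒≥ λ pos → <⇒≱ (s≤s (+-cancelʳ-≤ 8 _ 2 (≤-trans gap ≤10))) (leave-≥3 Q pos))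
        lP≡ : 8 * length (cycles P) + lP ≡ length (cycles Q) * 8
        lP≡ = *-cancelˡ-≡ _ _ 2 (+-cancelʳ-≡ n _ _ (begin
          2 * (8 * length (cycles P) + lP) + n                      ≡⟨ regroup (length (cycles P)) lP n ⟩
          2 * lP + 16 * length (cycles P) + n                       ≡⟨ trans (edge-count P) (sym (edge-count Q)) ⟩
          2 * length (leave Q) + 16 * length (cycles Q) + n         ≡⟨ cong (λ l → 2 * l + 16 * length (cycles Q) + n) leaveQ≡0 ⟩
          16 * length (cycles Q) + n                                ≡⟨ cong (_+ n) (regroup′ (length (cycles Q))) ⟩
          2 * (length (cycles Q) * 8) + n                           ∎))
          where
          open ≡-Reasoning
          regroup : ∀ c l k → 2 * (8 * c + l) + k ≡ 2 * l + 16 * c + k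
          regroup = solve-∀
          regroup′ : ∀ c → 16 * c ≡ 2 * (c * 8)
          regroup′ = solve-∀
        not-multiple : ∀ l → l ≤ 10 → 8 ≤ l → l ≢ 8 → ¬ (8 ∣ l)
        not-multiple _ _    () _   (divides 0 refl)
        not-multiple _ _    _  l≢8 (divides 1 refl) = l≢8 refl
        not-multiple _ l≤10 _  _   (divides (suc (suc q)) refl) = <⇒≱ (m≤m+n 11 (5 + q * 8)) l≤10

  -- Swapping a family for inside cycles, and lonely edges.

  -- Almost 2-perfection, phrased without the leave so that it can be restricted to part of a packing.
  Swappable : List (Cycle₈ n) → Set
  Swappable cs = Σ[ cs′ ∈ List (Cycle₈ n) ]
    Pointwise _InsideOf_ cs′ cs × AllPairs EdgeDisjoint cs′ × All (λ C′ → ∀ e → e ∈ᴱ C′ → cs covers e) cs′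

  uncovered∈leave : (P : Packing n) → ∀ {a b} → a Fin.< b → ¬ cycles P covers (a , b) → (a , b) ∈ leave P
  uncovered∈leave P a<b ¬c = ∈-filter⁺ (λ e → ¬? (cycles P covers? e))
    (∈-filter⁺ (uncurry Fin._<?_) (∈-cartesianProduct⁺ (∈-allFin _) (∈-allFin _)) a<b) ¬c

  -- An uncovered edge of an inside cycle would be in the leave once it is oriented increasingly, as
  -- the leave lists it. Decidability of covering then gives the positive statement.
  almost2Perfect⇒swappable : (P : Packing n) → Almost2Perfect P → Swappable (cycles P)
  almost2Perfect⇒swappable P (P′ , inside , avoid) = cycles P′ , inside , disjoint P′ , All.map (λ {C′} → covered {C′}) avoid
    where
    covered : ∀ {C′} → All (λ e → ¬ (e ∈ᴱ C′)) (leave P) → ∀ e → e ∈ᴱ C′ → cycles P covers e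
    covered {C′} avoids (a , b) e∈C′ = decidable-stable (cycles P covers? (a , b)) λ ¬c → absurd ¬c (<-cmp a b)
      where
      absurd : ¬ cycles P covers (a , b) → Tri (a Fin.< b) (a ≡ b) (b Fin.< a) → ⊥
      absurd ¬c (tri< a<b _ _)  = All.lookup avoids (uncovered∈leave P a<b ¬c) e∈C′
      absurd ¬c (tri≈ _ refl _) = ∈ᴱ-irrefl C′ e∈C′
      absurd ¬c (tri> _ _ b<a)  =
        All.lookup avoids (uncovered∈leave P b<a (¬c ∘ covers-sym (cycles P))) (∈ᴱ-sym C′ e∈C′)

  passes-inside : {cs′ cs : List (Cycle₈ n)} → Pointwise _InsideOf_ cs′ cs → ∀ x → passes cs′ x ≡ passes cs x
  passes-inside {[]}     {[]}    []                    x = refl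
  passes-inside {C′ ∷ _} {C ∷ _} ((same , _) ∷ inside) x =
    cong₂ _+_ (ind-cong (x ∈ⱽ? C′) (x ∈ⱽ? C) (Equivalence.to (same x)) (Equivalence.from (same x)))
              (passes-inside inside x)

  -- At every vertex both families use the same number of edges, so neither can cover more than the other.
  swap-covers : ∀ {cs} → AllPairs EdgeDisjoint cs → (s : Swappable cs) → ∀ e → cs covers e → proj₁ s covers e
  swap-covers {cs} dis (cs′ , inside , dis′ , cov) (x , y) c = decidable-stable (cs′ covers? (x , y)) λ ¬c′ →
    1≢0 (trans (sym (ind-yes (free? cs′ x y) (x≢y , ¬c′)))
               (trans (sym (same-free y)) (ind-no (free? cs x y) λ f → proj₂ f c)))
    where
    1≢0 : 1 ≢ 0
    1≢0 ()
    x≢y : x ≢ y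
    x≢y refl = covers-irrefl cs c
    covers′⇒covers : ∀ {e} → cs′ covers e → cs covers e
    covers′⇒covers {e} c′ with p , q ← All.lookupAny cov c′ = p e q
    monotone : ∀ z (f? : Dec (Free cs x z)) (f′? : Dec (Free cs′ x z)) → ind f? ≤ ind f′?
    monotone z (yes (x≢z , ¬c)) f′? = ≤-reflexive (sym (ind-yes f′? (x≢z , λ c′ → ¬c (covers′⇒covers c′))))
    monotone z (no _)           f′? = z≤n
    equation : leaveDegree cs x + (2 * passes cs x + 1) ≡ leaveDegree cs′ x + (2 * passes cs x + 1)
    equation = begin
      leaveDegree cs x + (2 * passes cs x + 1)    ≡⟨ sym (+-assoc (leaveDegree cs x) _ 1) ⟩
      leaveDegree cs x + 2 * passes cs x + 1      ≡⟨ trans (degree-equation dis x) (sym (degree-equation dis′ x)) ⟩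
      leaveDegree cs′ x + 2 * passes cs′ x + 1    ≡⟨ cong (λ p → leaveDegree cs′ x + 2 * p + 1) (passes-inside inside x) ⟩
      leaveDegree cs′ x + 2 * passes cs x + 1     ≡⟨ +-assoc (leaveDegree cs′ x) _ 1 ⟩
      leaveDegree cs′ x + (2 * passes cs x + 1)   ∎
      where open ≡-Reasoning
    same-free : ∀ z → ind (free? cs x z) ≡ ind (free? cs′ x z)
    same-free = ∑-rigid (λ z → monotone z (free? cs x z) (free? cs′ x z)) (+-cancelʳ-≡ _ _ _ equation)

  Lonely : List (Cycle₈ n) → Fin n → Fin n → Set
  Lonely cs a b = cs covers (a , b) × All (λ C → a ∈ⱽ C → b ∈ⱽ C → (a , b) ∈ᴱ C) cs

  -- An inside cycle covering the edge ab would have to lie inside the cycle that already uses ab.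
  lonely⇒¬swappable : ∀ {cs a b} → AllPairs EdgeDisjoint cs → Lonely cs a b → ¬ Swappable cs
  lonely⇒¬swappable {cs} {a} {b} dis (c , lonely) s@(cs′ , inside , _) = absurd inside lonely (swap-covers dis s (a , b) c)
    where
    absurd : ∀ {ds′ ds} → Pointwise _InsideOf_ ds′ ds → All (λ C → a ∈ⱽ C → b ∈ⱽ C → (a , b) ∈ᴱ C) ds →
             ¬ ds′ covers (a , b)
    absurd {C′ ∷ _} ((same , dis′) ∷ _) (l ∷ _) (here e) = dis′ (a , b) e
      (l (Equivalence.to (same a) (∈ᴱ⇒∈ⱽ C′ e)) (Equivalence.to (same b) (∈ᴱ⇒∈ⱽ C′ (∈ᴱ-sym C′ e))))
    absurd (_ ∷ inside) (_ ∷ ls) (there c) = absurd inside ls c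

-- Embedding cycles into a larger complete graph.

Image : (Fin m → Fin n) → Fin n → Set
Image f x = ∃[ a ] f a ≡ x

EdgesIn : (Fin n → Fin n → Set) → Cycle₈ n → Set
EdgesIn S C = ∀ a b → (a , b) ∈ᴱ C → S a b

-- The hypothesis on `S` and `T` concludes `a ≡ b` instead of a contradiction, so that two parts may
-- share a single vertex: a diagonal pair is no edge.
++-disjoint : {S T : Fin n → Fin n → Set} {cs ds : List (Cycle₈ n)} →
              AllPairs EdgeDisjoint cs → All (EdgesIn S) cs →
              AllPairs EdgeDisjoint ds → All (EdgesIn T) ds →
              (∀ {a b} → S a b → T a b → a ≡ b) → AllPairs EdgeDisjoint (cs ++ ds)
++-disjoint dis-cs cs⊆S dis-ds ds⊆T meet = AllPairs.++⁺ dis-cs dis-ds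
  (All.map (λ {C} C⊆S → All.map (λ D⊆T (a , b) e∈C e∈D → ∈ᴱ⇒≢ C e∈C (meet (C⊆S a b e∈C) (D⊆T a b e∈D))) ds⊆T) cs⊆S)

module Embedding {m n : ℕ} (f : Fin m → Fin n) (f-injective : Injective _≡_ _≡_ f) where

  embed : Cycle₈ m → Cycle₈ n
  embed C = record { vertex = f ∘ vertex C ; injective = injective C ∘ f-injective }

  embed-∈ᴱ⁺ : ∀ {a b} C → (a , b) ∈ᴱ C → (f a , f b) ∈ᴱ embed C
  embed-∈ᴱ⁺ C (i , inj₁ (refl , refl)) = i , inj₁ (refl , refl)
  embed-∈ᴱ⁺ C (i , inj₂ (refl , refl)) = i , inj₂ (refl , refl)

  embed-∈ᴱ⁻ : ∀ {a b} C → (f a , f b) ∈ᴱ embed C → (a , b) ∈ᴱ C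
  embed-∈ᴱ⁻ C (i , inj₁ (p , q)) = i , inj₁ (f-injective p , f-injective q)
  embed-∈ᴱ⁻ C (i , inj₂ (p , q)) = i , inj₂ (f-injective p , f-injective q)

  embed-EdgesIn : ∀ {S : Fin n → Fin n → Set} C → (∀ {a b} → (a , b) ∈ᴱ C → S (f a) (f b)) → EdgesIn S (embed C)
  embed-EdgesIn C C⊆S _ _ (i , inj₁ (refl , refl)) = C⊆S (i , inj₁ (refl , refl))
  embed-EdgesIn C C⊆S _ _ (i , inj₂ (refl , refl)) = C⊆S (i , inj₂ (refl , refl))

  embed-image : ∀ C → EdgesIn (λ x y → Image f x × Image f y) (embed C)
  embed-image C = embed-EdgesIn C λ _ → (_ , refl) , (_ , refl)

  embed-disjoint : ∀ {cs} → AllPairs EdgeDisjoint cs → AllPairs EdgeDisjoint (map embed cs)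
  embed-disjoint = AllPairs.map⁺ ∘ AllPairs.map λ {C} {D} C#D e → λ
    { (i , inj₁ (refl , refl)) e∈D → C#D _ (i , inj₁ (refl , refl)) (embed-∈ᴱ⁻ D e∈D)
    ; (i , inj₂ (refl , refl)) e∈D → C#D _ (i , inj₂ (refl , refl)) (embed-∈ᴱ⁻ D e∈D) }

  Lifts : Cycle₈ m → Cycle₈ n → Set
  Lifts D C′ = ∀ {a b} → (a , b) ∈ᴱ D → (f a , f b) ∈ᴱ C′

  -- All vertices of `C′` are images of vertices of `C`, so every position of `C′` names a position
  -- of `C`. Reading `C` in this order gives `D`.
  descend : ∀ {C C′} → C′ InsideOf embed C → Σ[ D ∈ Cycle₈ m ] D InsideOf C × Lifts D C′
  descend {C} {C′} (same , C′#C) = D , (same-vertices , D#C) , lifts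
    where
    index : Fin 8 → Fin 8
    index i = proj₁ (Equivalence.to (same (vertex C′ i)) (i , refl))
    lift : ∀ i → f (vertex C (index i)) ≡ vertex C′ i
    lift i = proj₂ (Equivalence.to (same (vertex C′ i)) (i , refl))
    D : Cycle₈ m
    D = record
      { vertex    = vertex C ∘ index
      ; injective = λ {i} {j} eq → injective C′ (trans (sym (lift i)) (trans (cong f eq) (lift j))) }
    lifts : Lifts D C′
    lifts (i , inj₁ (refl , refl)) = i , inj₁ (sym (lift i) , sym (lift (next i)))
    lifts (i , inj₂ (refl , refl)) = i , inj₂ (sym (lift i) , sym (lift (next i)))
    from : ∀ {x} → x ∈ⱽ C → x ∈ⱽ D
    from (k , refl) with i , eq ← Equivalence.from (same (f (vertex C k))) (k , refl) =
      i , f-injective (trans (lift i) eq)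
    same-vertices : ∀ x → x ∈ⱽ D ⇔ x ∈ⱽ C
    same-vertices x = mk⇔ (λ (i , eq) → index i , eq) from
    D#C : EdgeDisjoint D C
    D#C (a , b) e∈D e∈C = C′#C (f a , f b) (lifts e∈D) (embed-∈ᴱ⁺ C e∈C)

  -- The inside cycles of the embedded part pull back by `descend`. Their edges are covered by the
  -- whole family and have both ends in the image of `f`, where `rest` has no edge, so `cs` itself
  -- covers them.
  swappable-restrict : ∀ cs rest → All (EdgesIn λ x y → ¬ (Image f x × Image f y)) rest →
                       Swappable (map embed cs ++ rest) → Swappable cs
  swappable-restrict cs rest outside (cs′ , inside , dis , cov) =
    let ds , ds-inside , lifts , ds-dis = descendAll cs inside dis
    in  ds , ds-inside , ds-dis , All.map (λ {D} l (a , b) e∈D → covered (covers-lift {D} l e∈D)) lifts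
    where
    -- The recursion follows `cs` and thereby drops the inside cycles of `rest`. Each new cycle
    -- remembers the member of `cs′` to which it lifts, which supplies disjointness and covering.
    descendAll : ∀ cs {cs′} → Pointwise _InsideOf_ cs′ (map embed cs ++ rest) → AllPairs EdgeDisjoint cs′ →
                 Σ[ ds ∈ List (Cycle₈ m) ]
                   Pointwise _InsideOf_ ds cs × All (λ D → Any (Lifts D) cs′) ds × AllPairs EdgeDisjoint ds
    descendAll []       _              _            = [] , [] , [] , []
    descendAll (C ∷ cs) {C′ ∷ cs′} (i ∷ inside) (C′# ∷ dis) =
      let D , D-inside , lift = descend {C} {C′} i
          ds , ds-inside , lifts , ds-dis = descendAll cs inside dis
      in  D ∷ ds , D-inside ∷ ds-inside , here lift ∷ All.map there lifts ,
          All.map (λ l (a , b) e∈D e∈D₂ → let C′#C₂ , lift₂ = All.lookupAny C′# l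
                                          in  C′#C₂ _ (lift e∈D) (lift₂ e∈D₂)) lifts ∷ ds-dis
    covers-lift : ∀ {D a b} → Any (Lifts D) cs′ → (a , b) ∈ᴱ D → (map embed cs ++ rest) covers (f a , f b)
    covers-lift l e∈D with c , lift ← All.lookupAny cov l = c _ (lift e∈D)
    covered : ∀ {a b} → (map embed cs ++ rest) covers (f a , f b) → cs covers (a , b)
    covered c with Any.++⁻ (map embed cs) c
    ... | inj₁ c₁ = Any.map (λ {C} → embed-∈ᴱ⁻ C) (Any.map⁻ c₁)
    ... | inj₂ c₂ with out , e∈ ← All.lookupAny outside c₂ = ⊥-elim (out _ _ e∈ ((_ , refl) , (_ , refl)))

-- Decompositions of complete bipartite graphs.

Apart : (Fin m → Fin N) → (Fin n → Fin N) → Set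
Apart l r = ∀ i j → l i ≢ r j

Joins : (Fin m → Fin N) → (Fin n → Fin N) → Fin N → Fin N → Set
Joins l r a b = (Image l a × Image r b) ⊎ (Image r a × Image l b)

-- When `l` and `r` are injective and apart, there are `m * n` edges between their images, so `size`
-- together with disjointness says that all of them are used.
record Bipartite {m n N : ℕ} (l : Fin m → Fin N) (r : Fin n → Fin N) : Set where
  field
    bicycles   : List (Cycle₈ N)
    bidisjoint : AllPairs EdgeDisjoint bicycles
    crossing   : All (EdgesIn (Joins l r)) bicycles
    size       : 8 * length bicycles ≡ m * n

open Bipartite public

bipartite-swap : {l : Fin m → Fin N} {r : Fin n → Fin N} → Bipartite l r → Bipartite r l
bipartite-swap {m} {n = n} B = record
  { bicycles   = bicycles B
  ; bidisjoint = bidisjoint B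
  ; crossing   = All.map (λ cross a b e → swap (cross a b e)) (crossing B)
  ; size       = trans (size B) (*-comm m n) }

↑ˡ≢↑ʳ : Apart {m} {m + n} (_↑ˡ n) (m ↑ʳ_)
↑ˡ≢↑ʳ {m} {n} i j eq with trans (sym (splitAt-↑ˡ m i n)) (trans (cong (splitAt m) eq) (splitAt-↑ʳ m n j))
... | ()

-- A common edge would have its left end in both halves of the left side, against injectivity of
-- `l`, or a vertex on both sides, against `l#r`.
bipartite-++ : {l : Fin (m + n) → Fin N} {r : Fin w → Fin N} → Injective _≡_ _≡_ l → Apart l r →
               Bipartite (l ∘ (_↑ˡ n)) r → Bipartite (l ∘ (m ↑ʳ_)) r → Bipartite l r
bipartite-++ {m} {n} {N} {w} {l} {r} l-inj l#r B B′ = record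
  { bicycles   = bicycles B ++ bicycles B′
  ; bidisjoint = ++-disjoint (bidisjoint B) (crossing B) (bidisjoint B′) (crossing B′) (λ s t → ⊥-elim (apart s t))
  ; crossing   = All.++⁺ (All.map (λ cross a b e → widen (_↑ˡ n) (cross a b e)) (crossing B))
                         (All.map (λ cross a b e → widen (m ↑ʳ_) (cross a b e)) (crossing B′))
  ; size       = begin
      8 * length (bicycles B ++ bicycles B′)               ≡⟨ cong (8 *_) (length-++ (bicycles B)) ⟩
      8 * (length (bicycles B) + length (bicycles B′))     ≡⟨ *-distribˡ-+ 8 (length (bicycles B)) _ ⟩
      8 * length (bicycles B) + 8 * length (bicycles B′)   ≡⟨ cong₂ _+_ (size B) (size B′) ⟩
      m * w + n * w                                        ≡⟨ sym (*-distribʳ-+ w m n) ⟩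
      (m + n) * w                                          ∎ }
  where
  open ≡-Reasoning
  widen : ∀ {k} (g : Fin k → Fin (m + n)) {a b} → Joins (l ∘ g) r a b → Joins l r a b
  widen g (inj₁ ((i , p) , q)) = inj₁ ((g i , p) , q)
  widen g (inj₂ (p , (i , q))) = inj₂ (p , (g i , q))
  apart : ∀ {a b} → Joins (l ∘ (_↑ˡ n)) r a b → Joins (l ∘ (m ↑ʳ_)) r a b → ⊥
  apart (inj₁ ((i , refl) , _)) (inj₁ ((j , q) , _)) = ↑ˡ≢↑ʳ _ _ (sym (l-inj q))
  apart (inj₁ ((i , refl) , _)) (inj₂ ((j , q) , _)) = l#r _ _ (sym q)
  apart (inj₂ ((i , refl) , _)) (inj₁ ((j , q) , _)) = l#r _ _ q
  apart (inj₂ (_ , (i , refl))) (inj₂ (_ , (j , q))) = ↑ˡ≢↑ʳ _ _ (sym (l-inj q))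

leftSide : ∀ m {n} → Fin (m + n) → Bool
leftSide m x = [ (λ _ → true) , (λ _ → false) ]′ (splitAt m x)

Alternating : ∀ m {n} → Cycle₈ (m + n) → Set
Alternating m C = ∀ i → leftSide m (vertex C i) ≢ leftSide m (vertex C (next i))

alternating? : ∀ m {n} (cs : List (Cycle₈ (m + n))) → Dec (All (Alternating m) cs)
alternating? m = All.all? λ C → all? λ i → ¬? (leftSide m (vertex C i) Bool.≟ leftSide m (vertex C (next i)))

-- Alternation is a Boolean test on a concrete small decomposition; it is done there once, and the
-- result is transported to any two disjoint vertex sets.
bipartite-embed : ∀ (cs : List (Cycle₈ (m + n))) → AllPairs EdgeDisjoint cs →
                  All (Alternating m) cs →
                  8 * length cs ≡ m * n → {l : Fin m → Fin N} {r : Fin n → Fin N} →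
                  Injective _≡_ _≡_ l → Injective _≡_ _≡_ r → Apart l r → Bipartite l r
bipartite-embed {m} {n} cs dis alternating count {l} {r} l-inj r-inj l#r = record
  { bicycles   = map embed cs
  ; bidisjoint = embed-disjoint dis
  ; crossing   = All.map⁺ (All.map (λ {C} alt → embed-EdgesIn C λ
      { (i , inj₁ (refl , refl)) → joins _ _ (alt i)
      ; (i , inj₂ (refl , refl)) → joins _ _ (alt i ∘ sym) }) alternating)
  ; size       = trans (cong (8 *_) (length-map embed cs)) count }
  where
  f : Fin (m + n) → Fin _
  f = [ l , r ]′ ∘ splitAt m
  f-injective : Injective _≡_ _≡_ f
  f-injective {x} {y} eq = trans (sym (join-splitAt m n x))
    (trans (cong (join m n) (go (splitAt m x) (splitAt m y) eq)) (join-splitAt m n y))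
    where
    go : ∀ s t → [ l , r ]′ s ≡ [ l , r ]′ t → s ≡ t
    go (inj₁ i) (inj₁ j) eq = cong inj₁ (l-inj eq)
    go (inj₁ i) (inj₂ j) eq = ⊥-elim (l#r _ _ eq)
    go (inj₂ i) (inj₁ j) eq = ⊥-elim (l#r _ _ (sym eq))
    go (inj₂ i) (inj₂ j) eq = cong inj₂ (r-inj eq)
  open Embedding f f-injective
  joins : ∀ x y → leftSide m x ≢ leftSide m y → Joins l r (f x) (f y)
  joins x y alt with splitAt m x | splitAt m y
  ... | inj₁ i | inj₁ j = contradiction refl alt
  ... | inj₁ i | inj₂ j = inj₁ ((i , refl) , (j , refl))
  ... | inj₂ i | inj₁ j = inj₂ ((i , refl) , (j , refl))
  ... | inj₂ i | inj₂ j = contradiction refl alt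

-- Gluing two packings with a bipartite decomposition.

module Gluing {p q m w N : ℕ}
  {f : Fin p → Fin N} (f-inj : Injective _≡_ _≡_ f) {g : Fin q → Fin N} (g-inj : Injective _≡_ _≡_ g)
  {l : Fin m → Fin N} {r : Fin w → Fin N} (f#r : Apart f r) (g#l : Apart g l)
  (meet : ∀ i i′ j j′ → f i ≡ g j → f i′ ≡ g j′ → f i ≡ f i′)
  (A : Packing p) (B : Packing q) (D : Bipartite l r)
  where

  private
    module F = Embedding f f-inj
    module G = Embedding g g-inj

    rest : List (Cycle₈ N)
    rest = map G.embed (cycles B) ++ bicycles D

    RestEdge : Fin N → Fin N → Set
    RestEdge x y = (Image g x × Image g y) ⊎ Joins l r x y

    rest-edges : All (EdgesIn RestEdge) rest
    rest-edges = All.++⁺ (All.map⁺ (All.universal (λ C a b e → inj₁ (G.embed-image C a b e)) (cycles B)))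
                         (All.map (λ cross a b e → inj₂ (cross a b e)) (crossing D))

    rest-disjoint : AllPairs EdgeDisjoint rest
    rest-disjoint = ++-disjoint (G.embed-disjoint (disjoint B)) (All.map⁺ (All.universal G.embed-image (cycles B)))
                                (bidisjoint D) (crossing D) λ
      { ((_ , p) , _) (inj₁ ((_ , q) , _)) → ⊥-elim (g#l _ _ (trans p (sym q)))
      ; (_ , (_ , p)) (inj₂ (_ , (_ , q))) → ⊥-elim (g#l _ _ (trans p (sym q))) }

    meet-rest : ∀ {x y} → Image f x × Image f y → RestEdge x y → x ≡ y
    meet-rest ((_ , refl) , (_ , refl)) (inj₁ ((_ , p) , (_ , q)))         = meet _ _ _ _ (sym p) (sym q)
    meet-rest (_ , (_ , refl))          (inj₂ (inj₁ (_ , (_ , p))))        = ⊥-elim (f#r _ _ (sym p))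
    meet-rest ((_ , refl) , _)          (inj₂ (inj₂ ((_ , p) , _)))        = ⊥-elim (f#r _ _ (sym p))

  -- By `meet` the images of `f` and `g` have at most one common vertex, hence no common edge. An
  -- edge of `D` has one end in the image of `r`, outside that of `f`, and one in the image of `l`,
  -- outside that of `g`.
  glue : Packing N
  glue = record
    { cycles   = map F.embed (cycles A) ++ rest
    ; disjoint = ++-disjoint (F.embed-disjoint (disjoint A)) (All.map⁺ (All.universal F.embed-image (cycles A)))
                             rest-disjoint rest-edges meet-rest }

  glue-length : length (cycles glue) ≡ length (cycles A) + (length (cycles B) + length (bicycles D))
  glue-length = trans (length-++ (map F.embed (cycles A)))
    (cong₂ _+_ (length-map F.embed (cycles A))
               (trans (length-++ (map G.embed (cycles B))) (cong (_+ length (bicycles D)) (length-map G.embed (cycles B)))))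

  -- By `meet-rest` an edge of the other cycles with both ends in the image of `f` would be a loop,
  -- so `swappable-restrict` applies to `A`.
  glue-¬swappable : ¬ Swappable (cycles A) → ¬ Swappable (cycles glue)
  glue-¬swappable ¬s s = ¬s (F.swappable-restrict (cycles A) rest outside s)
    where
    outside : All (EdgesIn λ x y → ¬ (Image f x × Image f y)) rest
    outside = All.map (λ {C} edge a b e images → ∈ᴱ⇒≢ C e (meet-rest images (edge a b e))) rest-edges

-- Concrete cycles written as rows of numerals.

Row : Set
Row = Vec ℕ 8

⟪_,_,_,_,_,_,_,_⟫ : ℕ → ℕ → ℕ → ℕ → ℕ → ℕ → ℕ → ℕ → Row
⟪ a , b , c , d , e , f , g , h ⟫ = a ∷ b ∷ c ∷ d ∷ e ∷ f ∷ g ∷ h ∷ []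

IsCycle : ℕ → Row → Set
IsCycle n r = (∀ i → lookup r i < n) × (∀ i j → lookup r i ≡ lookup r j → i ≡ j)

isCycle? : ∀ n r → Dec (IsCycle n r)
isCycle? n r = all? (λ i → lookup r i ℕ.<? n) ×-dec
  all? (λ i → all? λ j → (lookup r i ℕ.≟ lookup r j) →-dec (i ≟ j))

SharedEdge : Row → Row → Fin 8 → Fin 8 → Set
SharedEdge r s i j = (lookup r i ≡ lookup s j × lookup r (next i) ≡ lookup s (next j))
                   ⊎ (lookup r i ≡ lookup s (next j) × lookup r (next i) ≡ lookup s j)

-- Quantifying over the 64 pairs of positions and comparing numerals keeps the test cheap, whereas
-- `EdgeDisjoint` ranges over all pairs of vertices.
RowDisjoint : Row → Row → Set
RowDisjoint r s = ∀ i j → ¬ SharedEdge r s i j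

rowDisjoint? : ∀ r s → Dec (RowDisjoint r s)
rowDisjoint? r s = all? λ i → all? λ j → ¬?
  (((lookup r i ℕ.≟ lookup s j) ×-dec (lookup r (next i) ℕ.≟ lookup s (next j))) ⊎-dec
   ((lookup r i ℕ.≟ lookup s (next j)) ×-dec (lookup r (next i) ℕ.≟ lookup s j)))

module _ {n : ℕ} where

  cycle : ∀ r → IsCycle n r → Cycle₈ n
  cycle r (bound , distinct) = record
    { vertex    = λ i → fromℕ< (bound i)
    ; injective = λ {i} {j} eq → distinct i j (fromℕ<-injective _ _ (bound i) (bound j) eq) }

  cyclesOf : ∀ {rows} → All (IsCycle n) rows → List (Cycle₈ n)
  cyclesOf = All.reduce λ {r} → cycle r

  cycle-disjoint : ∀ {r s} (r✓ : IsCycle n r) (s✓ : IsCycle n s) → RowDisjoint r s →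
                   EdgeDisjoint (cycle r r✓) (cycle s s✓)
  cycle-disjoint {r} {s} (bound , _) (bound′ , _) r#s _ = λ
    { (i , inj₁ (p , q)) (j , inj₁ (p′ , q′)) → r#s i j (inj₁ (same i j p p′ , same (next i) (next j) q q′))
    ; (i , inj₁ (p , q)) (j , inj₂ (p′ , q′)) → r#s i j (inj₂ (same i (next j) p q′ , same (next i) j q p′))
    ; (i , inj₂ (p , q)) (j , inj₁ (p′ , q′)) → r#s i j (inj₂ (same i (next j) p q′ , same (next i) j q p′))
    ; (i , inj₂ (p , q)) (j , inj₂ (p′ , q′)) → r#s i j (inj₁ (same i j p p′ , same (next i) (next j) q q′)) }
    where
    same : ∀ {x} i j → fromℕ< (bound i) ≡ x → fromℕ< (bound′ j) ≡ x → lookup r i ≡ lookup s j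
    same i j p q = fromℕ<-injective _ _ (bound i) (bound′ j) (trans p (sym q))

  cyclesOf-disjoint : ∀ {rows} (✓ : All (IsCycle n) rows) → AllPairs RowDisjoint rows → AllPairs EdgeDisjoint (cyclesOf ✓)
  cyclesOf-disjoint [] [] = []
  cyclesOf-disjoint {r ∷ _} (r✓ ∷ ✓) (r# ∷ #) = head ✓ r# ∷ cyclesOf-disjoint ✓ #
    where
    head : ∀ {rows} (✓ : All (IsCycle n) rows) → All (RowDisjoint r) rows → All (EdgeDisjoint (cycle r r✓)) (cyclesOf ✓)
    head []       []         = []
    head {s ∷ _} (s✓ ∷ ✓) (r#s ∷ r#) = cycle-disjoint {r} {s} r✓ s✓ r#s ∷ head ✓ r#

  packing : (rows : List Row) {✓ : True (All.all? (isCycle? n) rows)}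
            {# : True (AllPairs.allPairs? rowDisjoint? rows)} → Packing n
  packing rows {✓} {#} = record
    { cycles   = cyclesOf (toWitness ✓)
    ; disjoint = cyclesOf-disjoint (toWitness ✓) (toWitness #) }

lonely? : ∀ {n} (cs : List (Cycle₈ n)) a b → Dec (Lonely cs a b)
lonely? cs a b = (cs covers? (a , b)) ×-dec All.all? (λ C → (a ∈ⱽ? C) →-dec ((b ∈ⱽ? C) →-dec ((a , b) ∈ᴱ? C))) cs

-- Exhaustive search for inside cycles.

_steps_ : ℕ → Fin 8 → Fin 8
zero  steps i = i
suc k steps i = k steps next i

next-steps : ∀ k i → next (k steps i) ≡ k steps next i
next-steps zero    i = refl
next-steps (suc k) i = next-steps k (next i)

steps-return : ∀ k → k ≡ 7 → ∀ i → suc k steps i ≡ i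
steps-return _ refl = toWitness {a? = all? λ i → 8 steps i ≟ i} _

steps-injective : ∀ i {j k} → j < 8 → k < 8 → j steps i ≡ k steps i → j ≡ k
steps-injective i {j} {k} j<8 k<8 eq = trans (sym (toℕ-fromℕ< j<8)) (trans
  (cong toℕ (checked i (fromℕ< j<8) (fromℕ< k<8)
    (trans (cong (_steps i) (toℕ-fromℕ< j<8)) (trans eq (cong (_steps i) (sym (toℕ-fromℕ< k<8)))))))
  (toℕ-fromℕ< k<8))
  where
  checked : ∀ i (j k : Fin 8) → toℕ j steps i ≡ toℕ k steps i → j ≡ k
  checked = toWitness {a? = all? λ i → all? λ j → all? λ k → (toℕ j steps i ≟ toℕ k steps i) →-dec (j ≟ k)} _

module _ {n : ℕ} where

  Edge : Set
  Edge = Fin n × Fin n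

  SameEdge : Edge → Edge → Set
  SameEdge (a , b) (c , d) = (a ≡ c × b ≡ d) ⊎ (a ≡ d × b ≡ c)

  sameEdge? : ∀ e e′ → Dec (SameEdge e e′)
  sameEdge? (a , b) (c , d) = ((a ≟ c) ×-dec (b ≟ d)) ⊎-dec ((a ≟ d) ×-dec (b ≟ c))

  Clear : List Edge → List Edge → Set
  Clear h g = All (λ e → All (λ e′ → ¬ SameEdge e e′) g) h

  clear? : ∀ h g → Dec (Clear h g)
  clear? h g = All.all? (λ e → All.all? (λ e′ → ¬? (sameEdge? e e′)) g) h

  -- Edge lists of the walks that leave `x`, pass `k` vertices outside `visited` without repetition
  -- and close up at `s`, where `t` lists the permitted steps. For `k = 7` and `x = s` these are
  -- candidates for 8-cycles through `s`.
  walks : Vec (List (Fin n)) n → ℕ → Fin n → Fin n → List (Fin n) → List (List Edge)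
  walks t zero    s x visited = map (λ _ → [ (x , s) ]) (filter (s ≟_) (lookup t x))
  walks t (suc k) s x visited = concatMap (λ y → map ((x , y) ∷_) (walks t k s y (y ∷ visited)))
    (filter (λ y → All.all? (λ v → ¬? (v ≟ y)) visited) (lookup t x))

  -- The search serves to refute, so every genuine cycle has to appear in it. The induction shifts
  -- the sequence `u` by one and moves its next vertex to the visited ones.
  walks-complete : ∀ t k s (u : ℕ → Fin n) visited →
    (∀ {i} → i ≤ k → u (suc i) ∈ lookup t (u i)) → u (suc k) ≡ s →
    (∀ {i} → i < k → All (_≢ u (suc i)) visited) →
    (∀ {i j} → i < j → j < k → u (suc i) ≢ u (suc j)) →
    ∃[ h ] h ∈ walks t k s (u 0) visited × All (λ e → ∃[ i ] e ≡ (u i , u (suc i))) h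
  walks-complete t zero s u visited step refl fresh distinct =
    _ , ∈-map⁺ (λ _ → [ (u 0 , s) ]) (∈-filter⁺ (s ≟_) (step z≤n) refl) , (0 , refl) ∷ []
  walks-complete t (suc k) s u visited step end fresh distinct =
    let h , h∈ , edges = walks-complete t k s (u ∘ suc) (u 1 ∷ visited) (step ∘ s≤s) end
          (λ i<k → distinct (s≤s z≤n) (s≤s i<k) ∷ fresh (s≤s i<k))
          (λ i<j j<k → distinct (s≤s i<j) (s≤s j<k))
    in  (u 0 , u 1) ∷ h ,
        ∈-concat⁺′ (∈-map⁺ ((u 0 , u 1) ∷_) h∈)
          (∈-map⁺ (λ y → map ((u 0 , y) ∷_) (walks t k s y (y ∷ visited)))
            (∈-filter⁺ (λ y → All.all? (λ v → ¬? (v ≟ y)) visited) (step z≤n) (fresh (s≤s z≤n)))) ,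
        (0 , refl) ∷ All.map (λ (i , eq) → suc i , eq) edges

  -- Conditions that every step of an inside cycle of `C` with edges covered by `cs` must satisfy.
  Allowed : List (Cycle₈ n) → Cycle₈ n → Fin n → Fin n → Set
  Allowed cs C x y = y ∈ⱽ C × ¬ (x , y) ∈ᴱ C × cs covers (x , y)

  allowed? : ∀ cs C x y → Dec (Allowed cs C x y)
  allowed? cs C x y = (y ∈ⱽ? C) ×-dec (¬? ((x , y) ∈ᴱ? C) ×-dec (cs covers? (x , y)))

  allowedSteps : List (Cycle₈ n) → Cycle₈ n → Vec (List (Fin n)) n
  allowedSteps cs C = Vec.tabulate λ x → filter (allowed? cs C x) (allFin n)

  closedWalks : List (Cycle₈ n) → ℕ → Cycle₈ n → List (List Edge)
  closedWalks cs k C = walks (allowedSteps cs C) k (vertex C zero) (vertex C zero) [ vertex C zero ]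

  -- The length is a variable here, since the literal 7 would make type checking unfold the walks.
  closedWalks-complete : ∀ cs {C C′} → C′ InsideOf C → (∀ e → e ∈ᴱ C′ → cs covers e) →
                         ∀ k → k ≡ 7 → ∃[ h ] h ∈ closedWalks cs k C × All (_∈ᴱ C′) h
  closedWalks-complete cs {C} {C′} (same , C′#C) cov k k≡7 = h , h∈′ , All.map inC′ (proj₂ (proj₂ complete))
    where
    s = vertex C zero
    -- The listing of `C′` may begin anywhere; it is read from the position where it meets the first
    -- vertex of `C`.
    i = proj₁ (Equivalence.from (same s) (zero , refl))
    u : ℕ → Fin n
    u j = vertex C′ (j steps i)
    start : u 0 ≡ s
    start = proj₂ (Equivalence.from (same s) (zero , refl))
    edge : ∀ j → (u j , u (suc j)) ∈ᴱ C′
    edge j = j steps i , inj₁ (refl , cong (vertex C′) (next-steps j i))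
    allowed : ∀ j → u (suc j) ∈ lookup (allowedSteps cs C) (u j)
    allowed j = subst (u (suc j) ∈_) (sym (lookup∘tabulate _ (u j))) (∈-filter⁺ (allowed? cs C (u j)) (∈-allFin _)
      (Equivalence.to (same _) (_ , refl) , C′#C _ (edge j) , cov _ (edge j)))
    <8 : ∀ {j} → j < k → suc j < 8
    <8 j<k = s≤s (subst (_ <_) k≡7 j<k)
    fresh : ∀ {j} → j < k → s ≢ u (suc j)
    fresh j<k eq = 0≢1+n (steps-injective i (s≤s z≤n) (<8 j<k) (injective C′ (trans start eq)))
    distinct : ∀ {j l} → j < l → l < k → u (suc j) ≢ u (suc l)
    distinct j<l l<k eq = <⇒≢ (s≤s j<l) (steps-injective i (<8 (<-trans j<l l<k)) (<8 l<k) (injective C′ eq))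
    complete = walks-complete (allowedSteps cs C) k s u [ s ] (λ {j} _ → allowed j)
      (trans (cong (vertex C′) (steps-return k k≡7 i)) start)
      (λ j<k → fresh j<k ∷ []) distinct
    h = proj₁ complete
    h∈′ : h ∈ closedWalks cs k C
    h∈′ = subst (λ x → h ∈ walks (allowedSteps cs C) k s x [ s ]) start (proj₁ (proj₂ complete))
    inC′ : ∀ {e} → ∃[ j ] e ≡ (u j , u (suc j)) → e ∈ᴱ C′
    inC′ (j , refl) = edge j

  -- Backtracking: after a candidate is chosen for one cycle, all candidates sharing an edge with it
  -- are struck from the later lists.
  Solvable : ∀ {k} → Vec (List (List Edge)) k → Set
  Solvable []           = ⊤
  Solvable (hs ∷ rest) = Any (λ h → Solvable (Vec.map (filter (clear? h)) rest)) hs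

  solvable? : ∀ {k} (hss : Vec (List (List Edge)) k) → Dec (Solvable hss)
  solvable? []           = yes tt
  solvable? (hs ∷ rest) = Any.any? (λ h → solvable? (Vec.map (filter (clear? h)) rest)) hs

  infixr 5 _∷_
  data Selection : ∀ {k} → List (List Edge) → Vec (List (List Edge)) k → Set where
    []  : Selection [] []
    _∷_ : ∀ {k h hs g} {hss : Vec (List (List Edge)) k} → h ∈ hs → Selection g hss → Selection (h ∷ g) (hs ∷ hss)

  selection-filter : ∀ {k h g} {hss : Vec (List (List Edge)) k} → All (Clear h) g → Selection g hss →
                     Selection g (Vec.map (filter (clear? h)) hss)
  selection-filter []       []        = []
  selection-filter {h = h} (c ∷ cs) (h∈ ∷ sel) = ∈-filter⁺ (clear? h) h∈ c ∷ selection-filter cs sel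

  -- Pairwise clear choices are never struck out by one another, so the search can follow them to
  -- the end.
  selection⇒solvable : ∀ {k g} {hss : Vec (List (List Edge)) k} → AllPairs Clear g → Selection g hss → Solvable hss
  selection⇒solvable []       []         = tt
  selection⇒solvable (c ∷ cs) (h∈ ∷ sel) = lose h∈ (selection⇒solvable cs (selection-filter c sel))

  SubsetOf : List Edge → Cycle₈ n → Set
  SubsetOf h C = All (_∈ᴱ C) h

  clear : ∀ {C D h g} → EdgeDisjoint C D → SubsetOf h C → SubsetOf g D → Clear h g
  clear {D = D} C#D h⊆C g⊆D = All.map (λ e∈C → All.map (λ f∈D → λ
    { (inj₁ (refl , refl)) → C#D _ e∈C f∈D
    ; (inj₂ (refl , refl)) → C#D _ e∈C (∈ᴱ-sym D f∈D) }) g⊆D) h⊆C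

  -- Each inside cycle yields a candidate whose edges lie on it; as the inside cycles are
  -- edge-disjoint, these candidates are pairwise clear.
  swappable⇒solvable : ∀ cs → Swappable cs → ∀ k → k ≡ 7 → Solvable (Vec.map (closedWalks cs k) (Vec.fromList cs))
  swappable⇒solvable cs (cs′ , inside , dis , cov) k k≡7 =
    let g , sel , subs = select cs cs′ inside cov in selection⇒solvable (allClear subs dis) sel
    where
    select : ∀ ds ds′ → Pointwise _InsideOf_ ds′ ds → All (λ C′ → ∀ e → e ∈ᴱ C′ → cs covers e) ds′ →
             ∃[ g ] Selection g (Vec.map (closedWalks cs k) (Vec.fromList ds)) × Pointwise SubsetOf g ds′
    select []       []         []            []        = [] , [] , []
    select (C ∷ ds) (C′ ∷ ds′) (i ∷ inside) (c ∷ cov) =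
      let h , h∈ , h⊆ = closedWalks-complete cs {C} {C′} i c k k≡7
          g , sel , subs = select ds ds′ inside cov
      in  h ∷ g , h∈ ∷ sel , h⊆ ∷ subs
    clearOne : ∀ {C ds g h} → SubsetOf h C → Pointwise SubsetOf g ds → All (EdgeDisjoint C) ds → All (Clear h) g
    clearOne h⊆ []          []        = []
    clearOne {C} {D ∷ _} h⊆ (g⊆ ∷ subs) (C# ∷ C#s) = clear {C} {D} C# h⊆ g⊆ ∷ clearOne {C} h⊆ subs C#s
    allClear : ∀ {ds g} → Pointwise SubsetOf g ds → AllPairs EdgeDisjoint ds → AllPairs Clear g
    allClear []          []         = []
    allClear {C ∷ _} (h⊆ ∷ subs) (C# ∷ dis) = clearOne {C} h⊆ subs C# ∷ allClear subs dis

-- Bipartite decompositions from two small ones.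

K₄,₄ : Packing 8
K₄,₄ = packing
  ( ⟪ 0 , 4 , 1 , 5 , 2 , 6 , 3 , 7 ⟫
  ∷ ⟪ 0 , 5 , 3 , 4 , 2 , 7 , 1 , 6 ⟫
  ∷ [] )

K₆,₄ : Packing 10
K₆,₄ = packing
  ( ⟪ 0 , 6 , 3 , 9 , 2 , 8 , 1 , 7 ⟫
  ∷ ⟪ 0 , 8 , 4 , 7 , 5 , 6 , 1 , 9 ⟫
  ∷ ⟪ 2 , 6 , 4 , 9 , 5 , 8 , 3 , 7 ⟫
  ∷ [] )

-- K₄₊₂ⱼ,₄ is cut into copies of K₄,₄ and at most one copy of K₆,₄.
bipartite-4 : ∀ j {l : Fin (4 + j * 2) → Fin N} {r : Fin 4 → Fin N} →
              Injective _≡_ _≡_ l → Injective _≡_ _≡_ r → Apart l r → Bipartite l r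
bipartite-4 0 = bipartite-embed (cycles K₄,₄) (disjoint K₄,₄) (toWitness {a? = alternating? 4 (cycles K₄,₄)} _) refl
bipartite-4 1 = bipartite-embed (cycles K₆,₄) (disjoint K₆,₄) (toWitness {a? = alternating? 6 (cycles K₆,₄)} _) refl
bipartite-4 (suc (suc j)) l-inj r-inj l#r = bipartite-++ {4} {4 + j * 2} l-inj l#r
  (bipartite-4 0 (↑ˡ-injective _ _ _ ∘ l-inj) r-inj (λ _ → l#r _))
  (bipartite-4 j (↑ʳ-injective 4 _ _ ∘ l-inj) r-inj (λ _ → l#r _))

-- The right side is cut into blocks of 4. The swaps are there because `bipartite-++` divides the
-- left side.
bipartite : ∀ j k {l : Fin (4 + j * 2) → Fin N} {r : Fin (k * 4) → Fin N} →
            Injective _≡_ _≡_ l → Injective _≡_ _≡_ r → Apart l r → Bipartite l r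
bipartite j zero    _ _ _ = record { bicycles = [] ; bidisjoint = [] ; crossing = [] ; size = sym (*-zeroʳ (4 + j * 2)) }
bipartite j (suc k) l-inj r-inj l#r = bipartite-swap (bipartite-++ {4} {k * 4} r-inj (λ i j eq → l#r j i (sym eq))
  (bipartite-swap (bipartite-4 j l-inj (↑ˡ-injective _ _ _ ∘ r-inj) (λ i _ → l#r i _)))
  (bipartite-swap (bipartite j k l-inj (↑ʳ-injective 4 _ _ ∘ r-inj) (λ i _ → l#r i _))))

-- Witnesses and their numerical conditions.

-- By `edge-count` the number of cycles determines the size of the leave, so the leave of a concrete
-- packing is never enumerated.
leave-length : ∀ {n} (P : Packing n) L → 2 * L + 16 * length (cycles P) + n ≡ n * n → length (leave P) ≡ L
leave-length {n} P L eq = *-cancelˡ-≡ _ _ 2 (+-cancelʳ-≡ _ _ _ (+-cancelʳ-≡ n _ _ (trans (edge-count P) (sym eq))))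

-- The numerical hypotheses of `Even.maximum` and `Odd.maximum`. Unlike `IsMaximum` they can be
-- evaluated, and they are easily followed through a gluing.
EvenMaximum OddMaximum : ∀ {n} → Packing n → Set
EvenMaximum {n} P = 2 * length (leave P) < n + 16
OddMaximum      P = length (leave P) ≤ 10 × length (leave P) ≢ 8

record EvenWitness (n : ℕ) : Set where
  constructor witness
  field
    P          : Packing n
    maximum    : EvenMaximum P
    ¬swappable : ¬ Swappable (cycles P)

record OddWitness (n : ℕ) : Set where
  constructor witness
  field
    P          : Packing n
    maximum    : OddMaximum P
    ¬swappable : ¬ Swappable (cycles P)

lonely : ∀ {n} (P : Packing n) a b → {True (lonely? (cycles P) a b)} → ¬ Swappable (cycles P)
lonely P a b {✓} = lonely⇒¬swappable (disjoint P) (toWitness ✓)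

evenLeave : ∀ {n} (P : Packing n) L → 2 * L + 16 * length (cycles P) + n ≡ n * n →
            {True (suc (2 * L) ℕ.≤? n + 16)} → EvenMaximum P
evenLeave {n} P L eq {✓} = subst (λ l → 2 * l < n + 16) (sym (leave-length P L eq)) (toWitness ✓)

oddLeave : ∀ {n} (P : Packing n) L → 2 * L + 16 * length (cycles P) + n ≡ n * n →
           {True (L ℕ.≤? 10)} → {False (L ℕ.≟ 8)} → OddMaximum P
oddLeave P L eq {≤10} {≢8} =
  subst (λ l → l ≤ 10 × l ≢ 8) (sym (leave-length P L eq)) (toWitness ≤10 , toWitnessFalse ≢8)

-- Explicit packings of small order.

-- The packings below were found by computer search. The leaves of K₁₂ and K₁₄ contain a star K₁,₉ at
-- the vertex 0, those of K₁₁, K₁₃ and K₁₅ two or three cycles through 0, so that few cycles pass 0.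

K₈ : Packing 8
K₈ = packing
  ( ⟪ 0 , 2 , 1 , 4 , 6 , 3 , 5 , 7 ⟫
  ∷ ⟪ 0 , 3 , 1 , 5 , 6 , 2 , 7 , 4 ⟫
  ∷ ⟪ 0 , 5 , 2 , 4 , 3 , 7 , 1 , 6 ⟫
  ∷ [] )

K₁₀ : Packing 10
K₁₀ = packing
  ( ⟪ 2 , 5 , 6 , 3 , 4 , 8 , 7 , 9 ⟫
  ∷ ⟪ 0 , 2 , 7 , 1 , 8 , 3 , 9 , 6 ⟫
  ∷ ⟪ 0 , 3 , 5 , 1 , 9 , 4 , 2 , 8 ⟫
  ∷ ⟪ 0 , 7 , 4 , 1 , 6 , 8 , 5 , 9 ⟫
  ∷ ⟪ 0 , 4 , 6 , 2 , 1 , 3 , 7 , 5 ⟫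
  ∷ [] )

K₁₂ : Packing 12
K₁₂ = packing
  ( ⟪ 0 , 10 , 2 , 8 , 5 , 4 , 7 , 11 ⟫
  ∷ ⟪ 1 , 2 , 9 , 7 , 6 , 11 , 8 , 10 ⟫
  ∷ ⟪ 1 , 3 , 4 , 2 , 6 , 5 , 9 , 8 ⟫
  ∷ ⟪ 1 , 4 , 6 , 8 , 3 , 7 , 5 , 11 ⟫
  ∷ ⟪ 1 , 5 , 2 , 3 , 9 , 6 , 10 , 7 ⟫
  ∷ ⟪ 1 , 6 , 3 , 5 , 10 , 4 , 11 , 9 ⟫
  ∷ ⟪ 2 , 7 , 8 , 4 , 9 , 10 , 3 , 11 ⟫
  ∷ [] )

K₁₄ : Packing 14
K₁₄ = packing
  ( ⟪ 0 , 10 , 9 , 5 , 12 , 7 , 1 , 11 ⟫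
  ∷ ⟪ 0 , 12 , 11 , 9 , 2 , 1 , 3 , 13 ⟫
  ∷ ⟪ 1 , 4 , 2 , 10 , 7 , 3 , 5 , 8 ⟫
  ∷ ⟪ 1 , 5 , 10 , 13 , 8 , 9 , 6 , 12 ⟫
  ∷ ⟪ 1 , 6 , 5 , 7 , 2 , 13 , 4 , 10 ⟫
  ∷ ⟪ 1 , 9 , 7 , 8 , 12 , 10 , 6 , 13 ⟫
  ∷ ⟪ 2 , 3 , 6 , 4 , 11 , 13 , 9 , 12 ⟫
  ∷ ⟪ 2 , 5 , 13 , 7 , 4 , 3 , 8 , 11 ⟫
  ∷ ⟪ 2 , 6 , 7 , 11 , 3 , 9 , 4 , 8 ⟫
  ∷ ⟪ 3 , 10 , 8 , 6 , 11 , 5 , 4 , 12 ⟫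
  ∷ [] )

K₁₆ : Packing 16
K₁₆ = packing
  ( ⟪ 0 , 2 , 13 , 10 , 12 , 14 , 4 , 8 ⟫
  ∷ ⟪ 0 , 3 , 12 , 15 , 7 , 1 , 4 , 9 ⟫
  ∷ ⟪ 0 , 4 , 11 , 3 , 6 , 10 , 1 , 14 ⟫
  ∷ ⟪ 0 , 5 , 15 , 11 , 12 , 8 , 6 , 13 ⟫
  ∷ ⟪ 0 , 6 , 1 , 8 , 5 , 3 , 4 , 7 ⟫
  ∷ ⟪ 0 , 10 , 15 , 1 , 9 , 6 , 5 , 12 ⟫
  ∷ ⟪ 0 , 11 , 1 , 5 , 10 , 3 , 9 , 15 ⟫
  ∷ ⟪ 1 , 2 , 6 , 11 , 14 , 9 , 13 , 3 ⟫
  ∷ ⟪ 1 , 12 , 4 , 15 , 2 , 11 , 8 , 13 ⟫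
  ∷ ⟪ 2 , 4 , 13 , 15 , 3 , 7 , 14 , 10 ⟫
  ∷ ⟪ 2 , 5 , 11 , 13 , 7 , 9 , 10 , 8 ⟫
  ∷ ⟪ 2 , 7 , 12 , 6 , 14 , 13 , 5 , 9 ⟫
  ∷ ⟪ 2 , 12 , 9 , 11 , 7 , 8 , 3 , 14 ⟫
  ∷ ⟪ 4 , 6 , 15 , 8 , 14 , 5 , 7 , 10 ⟫
  ∷ [] )

K₉ : Packing 9
K₉ = packing
  ( ⟪ 0 , 2 , 5 , 6 , 4 , 8 , 1 , 7 ⟫
  ∷ ⟪ 0 , 4 , 5 , 1 , 6 , 3 , 7 , 8 ⟫
  ∷ ⟪ 0 , 5 , 7 , 2 , 4 , 3 , 8 , 6 ⟫
  ∷ ⟪ 1 , 3 , 5 , 8 , 2 , 6 , 7 , 4 ⟫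
  ∷ [] )

K₁₁ : Packing 11
K₁₁ = packing
  ( ⟪ 0 , 4 , 6 , 5 , 8 , 3 , 9 , 7 ⟫
  ∷ ⟪ 0 , 6 , 1 , 10 , 5 , 2 , 9 , 8 ⟫
  ∷ ⟪ 0 , 9 , 5 , 7 , 3 , 1 , 8 , 10 ⟫
  ∷ ⟪ 1 , 4 , 2 , 7 , 6 , 10 , 3 , 5 ⟫
  ∷ ⟪ 1 , 7 , 4 , 8 , 6 , 2 , 10 , 9 ⟫
  ∷ ⟪ 2 , 3 , 6 , 9 , 4 , 10 , 7 , 8 ⟫
  ∷ [] )

K₁₃ : Packing 13
K₁₃ = packing
  ( ⟪ 0 , 5 , 12 , 4 , 7 , 1 , 3 , 11 ⟫
  ∷ ⟪ 0 , 6 , 8 , 4 , 9 , 10 , 12 , 7 ⟫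
  ∷ ⟪ 0 , 8 , 10 , 11 , 1 , 9 , 6 , 12 ⟫
  ∷ ⟪ 0 , 9 , 7 , 8 , 12 , 3 , 2 , 10 ⟫
  ∷ ⟪ 1 , 4 , 10 , 5 , 8 , 11 , 2 , 12 ⟫
  ∷ ⟪ 1 , 5 , 11 , 12 , 9 , 3 , 6 , 10 ⟫
  ∷ ⟪ 1 , 6 , 5 , 9 , 2 , 7 , 3 , 8 ⟫
  ∷ ⟪ 2 , 4 , 5 , 7 , 6 , 11 , 9 , 8 ⟫
  ∷ ⟪ 2 , 5 , 3 , 10 , 7 , 11 , 4 , 6 ⟫
  ∷ [] )

K₁₅ : Packing 15
K₁₅ = packing
  ( ⟪ 0 , 7 , 9 , 3 , 11 , 2 , 5 , 12 ⟫
  ∷ ⟪ 0 , 8 , 1 , 11 , 12 , 4 , 9 , 14 ⟫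
  ∷ ⟪ 0 , 9 , 12 , 13 , 8 , 3 , 14 , 10 ⟫
  ∷ ⟪ 0 , 11 , 4 , 5 , 10 , 8 , 6 , 13 ⟫
  ∷ ⟪ 1 , 3 , 13 , 2 , 7 , 8 , 4 , 14 ⟫
  ∷ ⟪ 1 , 4 , 6 , 10 , 11 , 5 , 14 , 13 ⟫
  ∷ ⟪ 1 , 5 , 8 , 9 , 2 , 3 , 6 , 12 ⟫
  ∷ ⟪ 1 , 6 , 11 , 14 , 2 , 4 , 7 , 10 ⟫
  ∷ ⟪ 1 , 7 , 3 , 5 , 13 , 4 , 10 , 9 ⟫
  ∷ ⟪ 2 , 6 , 9 , 11 , 7 , 14 , 12 , 10 ⟫
  ∷ ⟪ 2 , 8 , 11 , 13 , 9 , 5 , 7 , 12 ⟫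
  ∷ ⟪ 3 , 10 , 13 , 7 , 6 , 14 , 8 , 12 ⟫
  ∷ [] )

K₁₇ : Packing 17
K₁₇ = packing
  ( ⟪ 0 , 1 , 15 , 13 , 11 , 2 , 10 , 16 ⟫
  ∷ ⟪ 0 , 2 , 8 , 5 , 15 , 4 , 14 , 13 ⟫
  ∷ ⟪ 0 , 3 , 14 , 10 , 5 , 4 , 12 , 7 ⟫
  ∷ ⟪ 0 , 4 , 3 , 5 , 9 , 13 , 8 , 12 ⟫
  ∷ ⟪ 0 , 5 , 6 , 12 , 2 , 4 , 10 , 15 ⟫
  ∷ ⟪ 0 , 6 , 15 , 16 , 9 , 8 , 7 , 10 ⟫
  ∷ ⟪ 0 , 8 , 10 , 12 , 11 , 3 , 15 , 14 ⟫
  ∷ ⟪ 0 , 9 , 15 , 12 , 3 , 13 , 4 , 11 ⟫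
  ∷ ⟪ 1 , 2 , 15 , 7 , 11 , 8 , 4 , 16 ⟫
  ∷ ⟪ 1 , 3 , 9 , 7 , 14 , 11 , 16 , 13 ⟫
  ∷ ⟪ 1 , 4 , 7 , 6 , 8 , 16 , 12 , 5 ⟫
  ∷ ⟪ 1 , 6 , 11 , 5 , 7 , 16 , 3 , 10 ⟫
  ∷ ⟪ 1 , 7 , 3 , 6 , 2 , 9 , 14 , 12 ⟫
  ∷ ⟪ 1 , 8 , 14 , 16 , 2 , 13 , 6 , 9 ⟫
  ∷ ⟪ 1 , 11 , 9 , 10 , 6 , 16 , 5 , 14 ⟫
  ∷ ⟪ 2 , 3 , 8 , 15 , 11 , 10 , 13 , 5 ⟫
  ∷ ⟪ 2 , 7 , 13 , 12 , 9 , 4 , 6 , 14 ⟫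
  ∷ [] )

K₁₉ : Packing 19
K₁₉ = packing
  ( ⟪ 0 , 1 , 15 , 8 , 7 , 11 , 5 , 13 ⟫
  ∷ ⟪ 0 , 2 , 11 , 17 , 14 , 15 , 5 , 6 ⟫
  ∷ ⟪ 0 , 3 , 9 , 15 , 12 , 2 , 16 , 17 ⟫
  ∷ ⟪ 0 , 4 , 15 , 3 , 11 , 12 , 7 , 9 ⟫
  ∷ ⟪ 0 , 5 , 2 , 10 , 4 , 13 , 6 , 14 ⟫
  ∷ ⟪ 0 , 7 , 2 , 8 , 12 , 9 , 14 , 11 ⟫
  ∷ ⟪ 0 , 8 , 13 , 16 , 10 , 9 , 18 , 15 ⟫
  ∷ ⟪ 0 , 10 , 13 , 11 , 15 , 6 , 3 , 12 ⟫
  ∷ ⟪ 0 , 16 , 11 , 9 , 2 , 6 , 17 , 18 ⟫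
  ∷ ⟪ 1 , 2 , 17 , 7 , 18 , 14 , 5 , 16 ⟫
  ∷ ⟪ 1 , 3 , 7 , 4 , 8 , 5 , 9 , 13 ⟫
  ∷ ⟪ 1 , 4 , 11 , 18 , 5 , 10 , 3 , 8 ⟫
  ∷ ⟪ 1 , 5 , 17 , 9 , 6 , 11 , 10 , 18 ⟫
  ∷ ⟪ 1 , 6 , 10 , 12 , 13 , 2 , 14 , 7 ⟫
  ∷ ⟪ 1 , 9 , 16 , 15 , 13 , 18 , 3 , 14 ⟫
  ∷ ⟪ 1 , 10 , 8 , 14 , 4 , 5 , 3 , 17 ⟫
  ∷ ⟪ 1 , 11 , 8 , 18 , 2 , 15 , 17 , 12 ⟫
  ∷ ⟪ 3 , 13 , 17 , 8 , 6 , 4 , 12 , 16 ⟫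
  ∷ ⟪ 4 , 9 , 8 , 16 , 6 , 7 , 10 , 17 ⟫
  ∷ ⟪ 4 , 16 , 7 , 15 , 10 , 14 , 12 , 18 ⟫
  ∷ ⟪ 5 , 7 , 13 , 14 , 16 , 18 , 6 , 12 ⟫
  ∷ [] )

K₂₃ : Packing 23
K₂₃ = packing
  ( ⟪ 0 , 1 , 21 , 16 , 22 , 14 , 9 , 2 ⟫
  ∷ ⟪ 0 , 3 , 15 , 11 , 4 , 8 , 20 , 18 ⟫
  ∷ ⟪ 0 , 4 , 19 , 5 , 14 , 8 , 11 , 13 ⟫
  ∷ ⟪ 0 , 5 , 10 , 4 , 21 , 12 , 19 , 17 ⟫
  ∷ ⟪ 0 , 6 , 13 , 8 , 10 , 19 , 2 , 22 ⟫
  ∷ ⟪ 0 , 7 , 12 , 20 , 22 , 8 , 16 , 15 ⟫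
  ∷ ⟪ 0 , 8 , 3 , 19 , 6 , 7 , 13 , 12 ⟫
  ∷ ⟪ 0 , 9 , 12 , 14 , 17 , 8 , 18 , 19 ⟫
  ∷ ⟪ 0 , 10 , 14 , 20 , 7 , 2 , 15 , 21 ⟫
  ∷ ⟪ 0 , 11 , 7 , 10 , 13 , 16 , 9 , 20 ⟫
  ∷ ⟪ 0 , 14 , 4 , 18 , 10 , 22 , 6 , 16 ⟫
  ∷ ⟪ 1 , 2 , 10 , 15 , 17 , 4 , 13 , 5 ⟫
  ∷ ⟪ 1 , 3 , 6 , 14 , 19 , 13 , 17 , 10 ⟫
  ∷ ⟪ 1 , 4 , 12 , 3 , 13 , 22 , 17 , 18 ⟫
  ∷ ⟪ 1 , 6 , 18 , 3 , 17 , 16 , 19 , 11 ⟫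
  ∷ ⟪ 1 , 7 , 8 , 6 , 10 , 20 , 21 , 19 ⟫
  ∷ ⟪ 1 , 8 , 15 , 19 , 7 , 4 , 6 , 17 ⟫
  ∷ ⟪ 1 , 9 , 15 , 13 , 2 , 20 , 3 , 22 ⟫
  ∷ ⟪ 1 , 12 , 15 , 22 , 21 , 14 , 16 , 20 ⟫
  ∷ ⟪ 1 , 13 , 21 , 10 , 11 , 5 , 2 , 14 ⟫
  ∷ ⟪ 1 , 15 , 18 , 9 , 17 , 21 , 2 , 16 ⟫
  ∷ ⟪ 2 , 4 , 9 , 21 , 18 , 5 , 16 , 11 ⟫
  ∷ ⟪ 2 , 8 , 19 , 9 , 22 , 7 , 17 , 12 ⟫
  ∷ ⟪ 2 , 17 , 5 , 9 , 3 , 10 , 16 , 18 ⟫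
  ∷ ⟪ 3 , 5 , 15 , 20 , 11 , 9 , 7 , 16 ⟫
  ∷ ⟪ 3 , 7 , 14 , 18 , 12 , 6 , 21 , 11 ⟫
  ∷ ⟪ 3 , 14 , 15 , 6 , 11 , 18 , 7 , 21 ⟫
  ∷ ⟪ 4 , 15 , 7 , 5 , 21 , 8 , 12 , 16 ⟫
  ∷ ⟪ 4 , 20 , 13 , 9 , 8 , 5 , 12 , 22 ⟫
  ∷ ⟪ 5 , 20 , 6 , 9 , 10 , 12 , 11 , 22 ⟫
  ∷ ⟪ 11 , 14 , 13 , 18 , 22 , 19 , 20 , 17 ⟫
  ∷ [] )

-- Base cases.

K₁₀-¬swappable : ¬ Swappable (cycles K₁₀)
K₁₀-¬swappable s = toWitnessFalse {a? = solvable? (Vec.map (closedWalks (cycles K₁₀) 7) (Vec.fromList (cycles K₁₀)))} _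
  (swappable⇒solvable (cycles K₁₀) s 7 refl)

K₁₀-witness : EvenWitness 10
K₁₀-witness = witness K₁₀ (evenLeave K₁₀ 5 refl) K₁₀-¬swappable

K₁₂-witness : EvenWitness 12
-- The vertex 0 lies on a single cycle, so both edges of that cycle at 0 are lonely.
K₁₂-witness = witness K₁₂ (evenLeave K₁₂ 10 refl) (lonely K₁₂ (# 0) (# 10))

K₁₄-witness : EvenWitness 14
K₁₄-witness = witness K₁₄ (evenLeave K₁₄ 11 refl) (lonely K₁₄ (# 0) (# 10))

K₁₆-witness : EvenWitness 16
K₁₆-witness = witness K₁₆ (evenLeave K₁₆ 8 refl) (lonely K₁₆ (# 0) (# 2))

K₁₁-witness : OddWitness 11
K₁₁-witness = witness K₁₁ (oddLeave K₁₁ 7 refl) (lonely K₁₁ (# 0) (# 4))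

K₁₃-witness : OddWitness 13
K₁₃-witness = witness K₁₃ (oddLeave K₁₃ 6 refl) (lonely K₁₃ (# 0) (# 5))

K₁₅-witness : OddWitness 15
K₁₅-witness = witness K₁₅ (oddLeave K₁₅ 9 refl) (lonely K₁₅ (# 0) (# 7))

K₁₇-¬swappable : ¬ Swappable (cycles K₁₇)
K₁₇-¬swappable = lonely K₁₇ (# 0) (# 1)

K₁₇-witness : OddWitness 17
K₁₇-witness = witness K₁₇ (oddLeave K₁₇ 0 refl) K₁₇-¬swappable

K₁₉-witness : OddWitness 19
K₁₉-witness = witness K₁₉ (oddLeave K₁₉ 3 refl) (lonely K₁₉ (# 0) (# 1))

K₂₃-witness : OddWitness 23
K₂₃-witness = witness K₂₃ (oddLeave K₂₃ 5 refl) (lonely K₂₃ (# 0) (# 1))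

-- Growing the order by gluing.

-- The leave gains exactly the perfect matching of 4 edges missed by `K₈`, so both sides of the
-- bound in `EvenMaximum` grow by 8.
even-step : ∀ k → EvenWitness (10 + k * 2) → EvenWitness (10 + k * 2 + 8)
even-step k (witness A small ¬s) = witness glue small′ (glue-¬swappable ¬s)
  where
  p = 10 + k * 2
  D : Bipartite (_↑ˡ 8) (p ↑ʳ_)
  -- The sides have `4 + (3 + k) * 2 = 10 + k * 2` and `2 * 4 = 8` vertices.
  D = bipartite (3 + k) 2 (↑ˡ-injective 8 _ _) (↑ʳ-injective p _ _) ↑ˡ≢↑ʳ
  open Gluing (↑ˡ-injective 8 _ _) (↑ʳ-injective p _ _) ↑ˡ≢↑ʳ (λ i j eq → ↑ˡ≢↑ʳ j i (sym eq))
    (λ i _ j _ eq → ⊥-elim (↑ˡ≢↑ʳ i j eq)) A K₈ D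
  a = length (cycles A)
  L = length (leave A)
  count : length (cycles glue) ≡ a + (3 + p)
  count = trans glue-length (cong (λ d → a + (3 + d)) (*-cancelˡ-≡ _ _ 8 (trans (size D) (*-comm p 8))))
  L≡ : length (leave glue) ≡ L + 4
  L≡ = leave-length glue (L + 4) (begin
    2 * (L + 4) + 16 * length (cycles glue) + (p + 8)   ≡⟨ cong (λ c → 2 * (L + 4) + 16 * c + (p + 8)) count ⟩
    2 * (L + 4) + 16 * (a + (3 + p)) + (p + 8)          ≡⟨ regroup L a p ⟩
    (2 * L + 16 * a + p) + (16 * p + 64)                ≡⟨ cong (_+ (16 * p + 64)) (edge-count A) ⟩
    p * p + (16 * p + 64)                               ≡⟨ square p ⟩
    (p + 8) * (p + 8)                                   ∎)
    where
    open ≡-Reasoning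
    regroup : ∀ L a p → 2 * (L + 4) + 16 * (a + (3 + p)) + (p + 8) ≡ (2 * L + 16 * a + p) + (16 * p + 64)
    regroup = solve-∀
    square : ∀ p → p * p + (16 * p + 64) ≡ (p + 8) * (p + 8)
    square = solve-∀
  small′ : 2 * length (leave glue) < p + 8 + 16
  small′ = begin-strict
    2 * length (leave glue)   ≡⟨ trans (cong (2 *_) L≡) (*-distribˡ-+ 2 L 4) ⟩
    2 * L + 8                 <⟨ +-monoˡ-< 8 small ⟩
    p + 16 + 8                ≡⟨ trans (+-assoc p 16 8) (sym (+-assoc p 8 16)) ⟩
    p + 8 + 16                ∎
    where open ≤-Reasoning

even-witness : ∀ k → EvenWitness (10 + k * 2)
even-witness 0 = K₁₀-witness
even-witness 1 = K₁₂-witness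
even-witness 2 = K₁₄-witness
even-witness 3 = K₁₆-witness
even-witness (suc (suc (suc (suc k)))) = subst EvenWitness (+-comm (10 + k * 2) 8) (even-step k (even-witness k))

-- `K₁₇` has an empty leave and the bipartite part is fully used, so the leave has the size of that
-- of `B`. The obstruction comes from `K₁₇`, hence `B` may itself be almost 2-perfect.
odd-step : ∀ j (B : Packing (5 + j * 2)) → OddMaximum B → OddWitness (21 + j * 2)
odd-step j B max = witness glue (subst (λ l → l ≤ 10 × l ≢ 8) (sym L≡) max) (glue-¬swappable K₁₇-¬swappable)
  where
  q = 4 + j * 2
  g : Fin (suc q) → Fin (17 + q)
  g zero    = zero
  g (suc x) = 17 ↑ʳ x
  g-injective : Injective _≡_ _≡_ g
  g-injective {zero}  {zero}  _  = refl
  g-injective {suc x} {suc y} eq = cong suc (↑ʳ-injective 17 x y eq)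
  g#l : Apart g (λ i → suc i ↑ˡ q)
  g#l zero    _ ()
  g#l (suc x) i eq = ↑ˡ≢↑ʳ (suc i) x (sym eq)
  meet : ∀ i i′ j j′ → i ↑ˡ q ≡ g j → i′ ↑ˡ q ≡ g j′ → i ↑ˡ q ≡ i′ ↑ˡ q
  meet _ _  zero    zero    eq eq′ = trans eq (sym eq′)
  meet _ i′ zero    (suc y) eq eq′ = ⊥-elim (↑ˡ≢↑ʳ i′ y eq′)
  meet i _  (suc x) _       eq eq′ = ⊥-elim (↑ˡ≢↑ʳ i x eq)
  -- The shared vertex 0 is left out on the left: its edges to the new vertices belong to `B`. The
  -- other 16 vertices form 4 blocks of 4.
  D : Bipartite (λ i → suc i ↑ˡ q) (17 ↑ʳ_)
  D = bipartite-swap (bipartite j 4 (↑ʳ-injective 17 _ _)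
    (λ eq → Fin.suc-injective (↑ˡ-injective q _ _ eq)) (λ i j eq → ↑ˡ≢↑ʳ (suc j) i (sym eq)))
  open Gluing (↑ˡ-injective q _ _) g-injective ↑ˡ≢↑ʳ g#l meet K₁₇ B D
  b = length (cycles B)
  L = length (leave B)
  count : length (cycles glue) ≡ 17 + (b + 2 * q)
  count = trans glue-length (cong (λ d → 17 + (b + d)) (*-cancelˡ-≡ _ _ 8 (trans (size D) (*-assoc 8 2 q))))
  L≡ : length (leave glue) ≡ L
  L≡ = leave-length glue L (begin
    2 * L + 16 * length (cycles glue) + (17 + q)    ≡⟨ cong (λ c → 2 * L + 16 * c + (17 + q)) count ⟩
    2 * L + 16 * (17 + (b + 2 * q)) + (17 + q)      ≡⟨ regroup L b q ⟩
    (2 * L + 16 * b + suc q) + (288 + 32 * q)       ≡⟨ cong (_+ (288 + 32 * q)) (edge-count B) ⟩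
    suc q * suc q + (288 + 32 * q)                  ≡⟨ square q ⟩
    (17 + q) * (17 + q)                             ∎)
    where
    open ≡-Reasoning
    regroup : ∀ L b q → 2 * L + 16 * (17 + (b + 2 * q)) + (17 + q) ≡ (2 * L + 16 * b + suc q) + (288 + 32 * q)
    regroup = solve-∀
    square : ∀ q → suc q * suc q + (288 + 32 * q) ≡ (17 + q) * (17 + q)
    square = solve-∀

-- Five vertices carry no 8-cycle; all 10 edges form the leave, the largest size that `OddMaximum`
-- admits.
K₅ : Packing 5
K₅ = packing []

-- Orders 19 and 23 are given explicitly because `odd-step` does not reach them: an 8-cycle needs
-- four vertices on each side, so there is none between 16 and 2 vertices, and the leave on 7
-- vertices would have 21 edges.
odd-witness : ∀ k → OddWitness (11 + k * 2)
odd-witness 0 = K₁₁-witness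
odd-witness 1 = K₁₃-witness
odd-witness 2 = K₁₅-witness
odd-witness 3 = K₁₇-witness
odd-witness 4 = K₁₉-witness
odd-witness 5 = odd-step 0 K₅ (oddLeave K₅ 10 refl)
odd-witness 6 = K₂₃-witness
odd-witness 7 = odd-step 2 K₉ (oddLeave K₉ 4 refl)
-- Order `27 + k * 2` arises from order `11 + k * 2 = 5 + (3 + k) * 2`, which is 16 smaller.
odd-witness (suc (suc (suc (suc (suc (suc (suc (suc k)))))))) =
  odd-step (3 + k) (P (odd-witness k)) (maximum (odd-witness k))
  where open OddWitness

-- Assembling the two parities.

parity : ∀ m → ∃[ k ] (m ≡ k * 2 ⊎ m ≡ suc (k * 2))
parity zero = 0 , inj₁ refl
parity (suc zero) = 0 , inj₂ refl
parity (suc (suc m)) with parity m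
... | k , inj₁ refl = suc k , inj₁ refl
... | k , inj₂ refl = suc k , inj₂ refl

mainTheorem2 : (n : ℕ) → 10 ≤ n → Σ[ P ∈ Packing n ] (IsMaximum P × ¬ Almost2Perfect P)
mainTheorem2 n 10≤n = subst (λ n → Σ[ P ∈ Packing n ] (IsMaximum P × ¬ Almost2Perfect P)) (m+[n∸m]≡n 10≤n)
  (from-parity (n ∸ 10) (parity (n ∸ 10)))
  where
  from-parity : ∀ m → ∃[ k ] (m ≡ k * 2 ⊎ m ≡ suc (k * 2)) → Σ[ P ∈ Packing (10 + m) ] (IsMaximum P × ¬ Almost2Perfect P)
  from-parity _ (k , inj₁ refl) =
    P , Even.maximum (5 + k) (double k) P maximum , ¬swappable ∘ almost2Perfect⇒swappable P
    where
    open EvenWitness (even-witness k)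
    double : ∀ k → 10 + k * 2 ≡ 2 * (5 + k)
    double = solve-∀
  from-parity _ (k , inj₂ refl) =
    P , Odd.maximum (5 + k) (double k) P (proj₁ maximum) (proj₂ maximum) , ¬swappable ∘ almost2Perfect⇒swappable P
    where
    open OddWitness (odd-witness k)
    double : ∀ k → 11 + k * 2 ≡ suc (2 * (5 + k))
    double = solve-∀
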